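{- Any pure instance of EffHOL induces a tripos and a realizability topos. Explicitly: let $\Lambda$, $\mathcal V$, $\rightsquigarrow$ and the lifting $A\mapsto\overline A$ be the data associated with a pure instance of EffHOL as described in the context, and set $\Phi_{\mathrm{ef}}:=\{\lfloor P\rfloor\mid P\subseteq\mathcal P,\ \lfloor P\rfloor\subseteq\mathcal V\}$, $\mathrm E_{\mathrm{ef}}:=\Lambda$, and $\phi_1\xrightarrow{e}\phi_2$ iff $e\,p_1\in\overline{\phi_2}$ for all $p_1\in\phi_1$. Then the assignment sending a set $I$ to $\Phi_{\mathrm{ef}}^I$ preordered by $$\alpha\le_I\beta\iff\exists e\in\mathrm E_{\mathrm{ef}}\ \forall i\in I.\ \alpha(i)\xrightarrow{e}\beta(i),$$ with reindexing by precomposition, is a tripos over $\mathbf{Set}$, and hence the tripos-to-topos construction applied to it yields a topos.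
   Context: **Programs and erasure.** $\mathcal P$ is the set of (raw) programs $p::=x\mid\lambda x{:}\tau.p\mid p\,p\mid\Lambda X{:}\kappa.p\mid p\,\tau\mid[p]\mid\mathsf{let}\ x\leftarrow p\ \mathsf{in}\ p\mid(p,p)\mid\pi_1\,p\mid\pi_2\,p$, where $\kappa::=\star\mid\kappa\rightarrowtail\star$ are kinds and $\tau::=X\mid\tau\,\tau\mid\bar\Lambda_{X:\kappa}.\tau\mid\tau\to\tau\mid\prod_{X:\kappa}.\tau\mid M(\tau)$ are types. $\Lambda$ is the set of untyped terms $p::=x\mid\lambda x.p\mid p\,p\mid[p]\mid\mathsf{let}\ x\leftarrow p\ \mathsf{in}\ p\mid(p,p)\mid\pi_1p\mid\pi_2p$, up to $\alpha$-equivalence. In a pure instance, $M(\tau)$, $[p]$ and $\mathsf{let}$ stand for the chosen interpretations of these constructs by types and programs of the effect-free fragment. The erasure $\lfloor\cdot\rfloor:\mathcal P\to\Lambda$ removes type annotations, type abstractions and type applications and is homomorphic otherwise; $\lfloor P\rfloor$ is the image of a set $P$. **Values and reduction on $\Lambda$.** $\mathcal V$ consists of the values $V::=x\mid\lambda x.p\mid(V_1,V_2)$. The reduction $\rightsquigarrow$ on $\Lambda$ is that of the instance up to erasure; it contains $(\lambda x.p)\,V\rightsquigarrow p[x:=V]$, $\mathsf{let}\ x\leftarrow[p_1]\ \mathsf{in}\ p_2\rightsquigarrow p_2[x:=p_1]$ and $\pi_i\,(V_1,V_2)\rightsquigarrow V_i$. **Lifting.** The modality $\langle x\leftarrow p\rangle\varphi$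 of the instance (the specification stating that $\varphi$ holds of the result $x$ of running $p$), read in the set-theoretic metatheory (comprehension terms become sets, logical membership becomes membership, quantification becomes meta-quantification), gives $\overline A=\{p\mid\langle x\leftarrow p\rangle(x\in A)\}$ for a set $A$ of programs, carried to erased programs by $\overline{\lfloor A\rfloor}=\lfloor\overline A\rfloor$. It is viewed as an operation on subsets of $\Lambda$. For a pure instance it satisfies, for all sets $A,B$ of terms (as counterparts of the inference rules of EffHOL for the modality and for reduction): (1) $A\subseteq B$ implies $\overline A\subseteq\overline B$; (2) $p\in A$ implies $[p]\in\overline A$; (3) if $p_1\in\overline{\{x\mid p_2[x_1:=x]\in\overline A\}}$ then $(\mathsf{let}\ x_1\leftarrow p_1\ \mathsf{in}\ p_2)\in\overline A$; (4) if $p_1\rightsquigarrow p_2$ and $q[x:=p_2]\in\overline A$ then $q[x:=p_1]\in\overline A$. These four properties are to be taken as the given properties of the lifting. **Tripos.** A tripos over $\mathbf{Set}$ is a contravariant functor $\mathcal T$ from $\mathbf{Set}$ to Heyting prealgebras (preordered sets with finite meets, joins and implication up to isomorphism) such that each reindexing map has left and right adjoints satisfying the Beck–Chevalley condition, and which has a generic predicate: a set $\Sigma$ and $\mathrm{tr}\in\mathcal T(\Sigma)$ such that every $\alpha\in\mathcal T(I)$ is isomorphic to the reindexing of $\mathrm{tr}$ along some map $I\to\Sigma$. -}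

module Defs where

open import Level using (Level; _⊔_; 0ℓ) renaming (suc to lsuc)
open import Data.Bool.Base using (Bool; T)
open import Data.Nat.Base using (ℕ; zero; suc)
open import Data.Product.Base using (Σ; _×_; _,_; proj₁; ∃-syntax; swap)
open import Data.Product using (∃!)
open import Function.Base using (id; _∘_)
open import Function.Bundles using (_⇔_)
open import Relation.Binary.Core using (Rel)
open import Relation.Binary.Structures using (IsEquivalence)
open import Relation.Binary.Lattice.Structures using (IsHeytingAlgebra)
open import Relation.Binary.PropositionalEquality.Core using (_≡_; _≗_)

-- The metatheory is classical: under excluded middle the decidable subsets
-- are all the subsets.  Unlike X → Set, the powerset is then again a small
-- set, as the generic predicate of a tripos over Set requires.

Subset : Set → Set
Subset X = X → Bool

infix 4 _∈_ _⊆_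

_∈_ : {X : Set} → X → Subset X → Set
x ∈ A = T (A x)

_⊆_ : {X : Set} → Subset X → Subset X → Set
A ⊆ B = ∀ {x} → x ∈ A → x ∈ B

-- B is the direct image f(A).
IsImage : {X Y : Set} → (X → Y) → Subset X → Subset Y → Set
IsImage f A B = ∀ y → y ∈ B ⇔ (∃[ x ] (x ∈ A × f x ≡ y))

data Kind : Set where
  ⋆   : Kind
  _↣⋆ : Kind → Kind

-- De Bruijn indices throughout, type variables and program variables being
-- numbered independently.  Terms may be open: under n binders of its sort,
-- the index n + k denotes the k-th free variable.

data Type : Set where
  tvar : ℕ → Type
  tapp : Type → Type → Type
  tlam : Kind → Type → Type
  _⇒ᵗ_ : Type → Type → Type
  tall : Kind → Type → Type
  M    : Type → Type

data Program : Set where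
  var   : ℕ → Program
  lam   : Type → Program → Program
  app   : Program → Program → Program
  Lam   : Kind → Program → Program
  App   : Program → Type → Program
  ret   : Program → Program
  let′  : Program → Program → Program    -- binds in its second argument
  pair  : Program → Program → Program
  π₁ π₂ : Program → Program

data Λ : Set where
  var   : ℕ → Λ
  lam   : Λ → Λ
  app   : Λ → Λ → Λ
  ret   : Λ → Λ
  let′  : Λ → Λ → Λ
  pair  : Λ → Λ → Λ
  π₁ π₂ : Λ → Λ

⌊_⌋ : Program → Λ
⌊ var n ⌋    = var n
⌊ lam τ p ⌋  = lam ⌊ p ⌋
⌊ app p q ⌋  = app ⌊ p ⌋ ⌊ q ⌋
⌊ Lam κ p ⌋  = ⌊ p ⌋
⌊ App p τ ⌋  = ⌊ p ⌋
⌊ ret p ⌋    = ret ⌊ p ⌋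
⌊ let′ p q ⌋ = let′ ⌊ p ⌋ ⌊ q ⌋
⌊ pair p q ⌋ = pair ⌊ p ⌋ ⌊ q ⌋
⌊ π₁ p ⌋     = π₁ ⌊ p ⌋
⌊ π₂ p ⌋     = π₂ ⌊ p ⌋

liftʳ : (ℕ → ℕ) → ℕ → ℕ
liftʳ ρ zero    = zero
liftʳ ρ (suc n) = suc (ρ n)

rename : (ℕ → ℕ) → Λ → Λ
rename ρ (var n)    = var (ρ n)
rename ρ (lam p)    = lam (rename (liftʳ ρ) p)
rename ρ (app p q)  = app (rename ρ p) (rename ρ q)
rename ρ (ret p)    = ret (rename ρ p)
rename ρ (let′ p q) = let′ (rename ρ p) (rename (liftʳ ρ) q)
rename ρ (pair p q) = pair (rename ρ p) (rename ρ q)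
rename ρ (π₁ p)     = π₁ (rename ρ p)
rename ρ (π₂ p)     = π₂ (rename ρ p)

liftˢ : (ℕ → Λ) → ℕ → Λ
liftˢ σ zero    = var zero
liftˢ σ (suc n) = rename suc (σ n)

subst : (ℕ → Λ) → Λ → Λ
subst σ (var n)    = σ n
subst σ (lam p)    = lam (subst (liftˢ σ) p)
subst σ (app p q)  = app (subst σ p) (subst σ q)
subst σ (ret p)    = ret (subst σ p)
subst σ (let′ p q) = let′ (subst σ p) (subst (liftˢ σ) q)
subst σ (pair p q) = pair (subst σ p) (subst σ q)
subst σ (π₁ p)     = π₁ (subst σ p)
subst σ (π₂ p)     = π₂ (subst σ p)

single : Λ → ℕ → Λ
single q zero    = q
single q (suc n) = var n

infix 8 _[_]

-- p [ q ] is p[x := q], where x is the variable of index 0 in p; the indices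
-- of the other variables of p drop by one.
_[_] : Λ → Λ → Λ
p [ q ] = subst (single q) p

data IsValue : Λ → Set where
  var  : ∀ n → IsValue (var n)
  lam  : ∀ p → IsValue (lam p)
  pair : ∀ {v w} → IsValue v → IsValue w → IsValue (pair v w)

-- The interpretations an instance chooses for [p] and let enter through _⇝_
-- and lift; the grammar of terms keeps both constructs.
record PureInstance : Set₁ where
  infix 4 _⇝_
  field
    _⇝_   : Λ → Λ → Set
    ⇝-β   : ∀ {p v} → IsValue v → app (lam p) v ⇝ p [ v ]
    ⇝-let : ∀ {p₁ p₂} → let′ (ret p₁) p₂ ⇝ p₂ [ p₁ ]
    ⇝-π₁  : ∀ {v w} → IsValue v → IsValue w → π₁ (pair v w) ⇝ v
    ⇝-π₂  : ∀ {v w} → IsValue v → IsValue w → π₂ (pair v w) ⇝ w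

    -- liftᴾ P is the set of programs satisfying the modality ⟨x ← p⟩(x ∈ P).
    liftᴾ      : Subset Program → Subset Program
    lift       : Subset Λ → Subset Λ
    lift-erase : ∀ {P A} → IsImage ⌊_⌋ P A → IsImage ⌊_⌋ (liftᴾ P) (lift A)

    lift-mono : ∀ {A B} → A ⊆ B → lift A ⊆ lift B
    lift-ret  : ∀ {A p} → p ∈ A → ret p ∈ lift A
    lift-let  : ∀ {A p₁ p₂} →
                p₁ ∈ lift (λ x → lift A (p₂ [ x ])) → let′ p₁ p₂ ∈ lift A
    lift-⇝    : ∀ {A p₁ p₂} q →
                p₁ ⇝ p₂ → q [ p₂ ] ∈ lift A → q [ p₁ ] ∈ lift A

-- The category Set has Agda's small types as objects.
record IndexedPreorder : Set₁ where
  infix  4 _⊑_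
  infixr 9 _^*_
  field
    Pr   : Set → Set
    _⊑_  : ∀ {I} → Pr I → Pr I → Set
    _^*_ : ∀ {I J} → (I → J) → Pr J → Pr I

  infix 4 _≅_
  _≅_ : ∀ {I} → Pr I → Pr I → Set
  α ≅ β = α ⊑ β × β ⊑ α

IsPullbackSquare : {P I J K : Set} →
                   (P → I) → (P → J) → (I → K) → (J → K) → Set
IsPullbackSquare p q f g =
  (f ∘ p ≗ g ∘ q) ×
  (∀ i j → f i ≡ g j → ∃! _≡_ (λ x → p x ≡ i × q x ≡ j))

record IsTripos (𝓟 : IndexedPreorder) : Set₁ where
  open IndexedPreorder 𝓟
  infixr 7 _∧_
  infixr 6 _∨_
  infixr 5 _⇨_
  field
    ⊤ ⊥         : ∀ {I} → Pr I
    _∧_ _∨_ _⇨_ : ∀ {I} → Pr I → Pr I → Pr I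

    -- A Heyting algebra whose equality is isomorphism, that is, a Heyting
    -- prealgebra.
    isHeyting : ∀ {I} → IsHeytingAlgebra (_≅_ {I}) _⊑_ _∨_ _∧_ _⇨_ ⊤ ⊥

    ^*-mono : ∀ {I J} (f : I → J) {α β} → α ⊑ β → f ^* α ⊑ f ^* β
    ^*-⊤    : ∀ {I J} (f : I → J) → f ^* ⊤ ≅ ⊤
    ^*-⊥    : ∀ {I J} (f : I → J) → f ^* ⊥ ≅ ⊥
    ^*-∧    : ∀ {I J} (f : I → J) α β → f ^* (α ∧ β) ≅ f ^* α ∧ f ^* β
    ^*-∨    : ∀ {I J} (f : I → J) α β → f ^* (α ∨ β) ≅ f ^* α ∨ f ^* β
    ^*-⇨    : ∀ {I J} (f : I → J) α β → f ^* (α ⇨ β) ≅ f ^* α ⇨ f ^* β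

    ^*-id   : ∀ {I} (α : Pr I) → id ^* α ≡ α
    ^*-∘    : ∀ {I J K} (g : J → K) (f : I → J) α →
              (g ∘ f) ^* α ≡ f ^* g ^* α
    -- Maps of sets are equal when pointwise equal; in the absence of
    -- function extensionality this is respected up to isomorphism.
    ^*-cong : ∀ {I J} {f g : I → J} → f ≗ g → ∀ α → f ^* α ≅ g ^* α

    ∐ ∏     : ∀ {I J} → (I → J) → Pr I → Pr J
    ∐⊣^*    : ∀ {I J} (f : I → J) α β → (∐ f α ⊑ β) ⇔ (α ⊑ f ^* β)
    ^*⊣∏    : ∀ {I J} (f : I → J) β α → (f ^* β ⊑ α) ⇔ (β ⊑ ∏ f α)
    ∐-beckChevalley :
      ∀ {P I J K} {p : P → I} {q : P → J} {f : I → K} {g : J → K} →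
      IsPullbackSquare p q f g → ∀ α → g ^* ∐ f α ≅ ∐ q (p ^* α)
    ∏-beckChevalley :
      ∀ {P I J K} {p : P → I} {q : P → J} {f : I → K} {g : J → K} →
      IsPullbackSquare p q f g → ∀ α → g ^* ∏ f α ≅ ∏ q (p ^* α)

    Props      : Set
    tr         : Pr Props
    classify   : ∀ {I} → Pr I → (I → Props)
    classifies : ∀ {I} (α : Pr I) → α ≅ classify α ^* tr

record Category (o ℓ e : Level) : Set (lsuc (o ⊔ ℓ ⊔ e)) where
  infix  4 _≈_ _⇒_
  infixr 9 _∙_
  field
    Obj : Set o
    _⇒_ : Rel Obj ℓ
    _≈_ : ∀ {A B} → Rel (A ⇒ B) e
    idₘ : ∀ {A} → A ⇒ A
    _∙_ : ∀ {A B C} → B ⇒ C → A ⇒ B → A ⇒ C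

    ≈-isEquivalence : ∀ {A B} → IsEquivalence (_≈_ {A} {B})
    ∙-resp-≈  : ∀ {A B C} {f h : B ⇒ C} {g i : A ⇒ B} →
                f ≈ h → g ≈ i → f ∙ g ≈ h ∙ i
    identityˡ : ∀ {A B} {f : A ⇒ B} → idₘ ∙ f ≈ f
    identityʳ : ∀ {A B} {f : A ⇒ B} → f ∙ idₘ ≈ f
    assoc     : ∀ {A B C D} {f : A ⇒ B} {g : B ⇒ C} {h : C ⇒ D} →
                (h ∙ g) ∙ f ≈ h ∙ (g ∙ f)

module _ {o ℓ e} (𝓒 : Category o ℓ e) where
  open Category 𝓒

  Mono : ∀ {A B} → A ⇒ B → Set (o ⊔ ℓ ⊔ e)
  Mono {A} m = ∀ {Z} (f g : Z ⇒ A) → m ∙ f ≈ m ∙ g → f ≈ g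

  record IsPullback {P A B C} (p : P ⇒ A) (q : P ⇒ B) (f : A ⇒ C) (g : B ⇒ C)
                    : Set (o ⊔ ℓ ⊔ e) where
    field
      commute   : f ∙ p ≈ g ∙ q
      universal : ∀ {Z} (h : Z ⇒ A) (k : Z ⇒ B) → f ∙ h ≈ g ∙ k → Z ⇒ P
      p∙universal : ∀ {Z} {h : Z ⇒ A} {k : Z ⇒ B} (eq : f ∙ h ≈ g ∙ k) →
                    p ∙ universal h k eq ≈ h
      q∙universal : ∀ {Z} {h : Z ⇒ A} {k : Z ⇒ B} (eq : f ∙ h ≈ g ∙ k) →
                    q ∙ universal h k eq ≈ k
      unique    : ∀ {Z} {h : Z ⇒ A} {k : Z ⇒ B} (eq : f ∙ h ≈ g ∙ k)
                  (u : Z ⇒ P) → p ∙ u ≈ h → q ∙ u ≈ k → u ≈ universal h k eq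

  record IsTopos : Set (o ⊔ ℓ ⊔ e) where
    infixr 7 _⊗_
    field
      𝟙        : Obj
      !        : ∀ {A} → A ⇒ 𝟙
      !-unique : ∀ {A} (f : A ⇒ 𝟙) → f ≈ !

      _⊗_      : Obj → Obj → Obj
      fst      : ∀ {A B} → A ⊗ B ⇒ A
      snd      : ∀ {A B} → A ⊗ B ⇒ B
      ⟨_,_⟩    : ∀ {Z A B} → Z ⇒ A → Z ⇒ B → Z ⇒ A ⊗ B
      fst-⟨⟩   : ∀ {Z A B} (f : Z ⇒ A) (g : Z ⇒ B) → fst ∙ ⟨ f , g ⟩ ≈ f
      snd-⟨⟩   : ∀ {Z A B} (f : Z ⇒ A) (g : Z ⇒ B) → snd ∙ ⟨ f , g ⟩ ≈ g
      ⟨⟩-unique : ∀ {Z A B} (f : Z ⇒ A) (g : Z ⇒ B) (h : Z ⇒ A ⊗ B) →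
                  fst ∙ h ≈ f → snd ∙ h ≈ g → h ≈ ⟨ f , g ⟩

      Eq        : ∀ {A B} → A ⇒ B → A ⇒ B → Obj
      eq        : ∀ {A B} (f g : A ⇒ B) → Eq f g ⇒ A
      eq-commute : ∀ {A B} (f g : A ⇒ B) → f ∙ eq f g ≈ g ∙ eq f g
      eq-factor : ∀ {Z A B} (f g : A ⇒ B) (h : Z ⇒ A) →
                  f ∙ h ≈ g ∙ h → Z ⇒ Eq f g
      eq-∙-factor : ∀ {Z A B} (f g : A ⇒ B) (h : Z ⇒ A)
                    (e : f ∙ h ≈ g ∙ h) → eq f g ∙ eq-factor f g h e ≈ h
      eq-unique : ∀ {Z A B} (f g : A ⇒ B) (h : Z ⇒ A) (e : f ∙ h ≈ g ∙ h)
                  (k : Z ⇒ Eq f g) → eq f g ∙ k ≈ h → k ≈ eq-factor f g h e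

      _⇑_      : Obj → Obj → Obj
      eval     : ∀ {A B} → (B ⇑ A) ⊗ A ⇒ B
      curry    : ∀ {Z A B} → Z ⊗ A ⇒ B → Z ⇒ B ⇑ A
      eval-curry : ∀ {Z A B} (f : Z ⊗ A ⇒ B) →
                   eval ∙ ⟨ curry f ∙ fst , snd ⟩ ≈ f
      curry-unique : ∀ {Z A B} (f : Z ⊗ A ⇒ B) (g : Z ⇒ B ⇑ A) →
                     eval ∙ ⟨ g ∙ fst , snd ⟩ ≈ f → g ≈ curry f

      Ω        : Obj
      true     : 𝟙 ⇒ Ω
      χ        : ∀ {U A} (m : U ⇒ A) → Mono m → A ⇒ Ω
      χ-pullback : ∀ {U A} (m : U ⇒ A) (mono : Mono m) →
                   IsPullback m ! (χ m mono) true
      χ-unique : ∀ {U A} (m : U ⇒ A) (mono : Mono m) (c : A ⇒ Ω) →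
                 IsPullback m ! c true → c ≈ χ m mono

module TriposToTopos {𝓟 : IndexedPreorder} (tripos : IsTripos 𝓟) where
  open IndexedPreorder 𝓟
  open IsTripos tripos

  record PER : Set₁ where
    field
      ∣_∣ : Set
      ∼   : Pr (∣_∣ × ∣_∣)
      ∼-sym   : ∼ ⊑ swap ^* ∼
      ∼-trans : (λ (x , y , z) → x , y) ^* ∼
              ∧ (λ (x , y , z) → y , z) ^* ∼
              ⊑ (λ ((x , y , z) : ∣_∣ × ∣_∣ × ∣_∣) → x , z) ^* ∼

  open PER public

  record IsFunctional (X Y : PER) (F : Pr (∣ X ∣ × ∣ Y ∣)) : Set where
    field
      strict       : F ⊑ (λ (x , y) → x , x) ^* ∼ X
                       ∧ (λ (x , y) → y , y) ^* ∼ Y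
      extensional  : (λ (x , x′ , y , y′) → x , y) ^* F
                   ∧ (λ (x , x′ , y , y′) → x , x′) ^* ∼ X
                   ∧ (λ (x , x′ , y , y′) → y , y′) ^* ∼ Y
                   ⊑ (λ ((x , x′ , y , y′) : ∣ X ∣ × ∣ X ∣ × ∣ Y ∣ × ∣ Y ∣)
                          → x′ , y′) ^* F
      singleValued : (λ (x , y , y′) → x , y) ^* F
                   ∧ (λ (x , y , y′) → x , y′) ^* F
                   ⊑ (λ ((x , y , y′) : ∣ X ∣ × ∣ Y ∣ × ∣ Y ∣)
                          → y , y′) ^* ∼ Y
      total        : (λ x → x , x) ^* ∼ X ⊑ ∐ proj₁ F

  record FunctionalRelation (X Y : PER) : Set where
    field
      rel          : Pr (∣ X ∣ × ∣ Y ∣)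
      isFunctional : IsFunctional X Y rel

  open FunctionalRelation public

  -- ∃ y. F(x,y) ∧ G(y,z)
  compose : ∀ {A B C : Set} → Pr (B × C) → Pr (A × B) → Pr (A × C)
  compose {A} {B} {C} G F =
    ∐ (λ ((x , y , z) : A × B × C) → x , z)
      ( (λ (x , y , z) → x , y) ^* F
      ∧ (λ (x , y , z) → y , z) ^* G )

  -- That ∼ and relational composition are functional is part of the
  -- assertion, so it is interleaved with the category laws.
  record IsCategorical : Set₁ where
    field
      id-functional : ∀ X → IsFunctional X X (∼ X)
      ∘-functional  : ∀ {X Y Z} {G : Pr (∣ Y ∣ × ∣ Z ∣)}
                      {F : Pr (∣ X ∣ × ∣ Y ∣)} →
                      IsFunctional Y Z G → IsFunctional X Y F →
                      IsFunctional X Z (compose G F)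

    _⇒_ : PER → PER → Set
    _⇒_ = FunctionalRelation

    _≈_ : ∀ {X Y} → X ⇒ Y → X ⇒ Y → Set
    F ≈ G = rel F ≅ rel G

    idₘ : ∀ {X} → X ⇒ X
    idₘ {X} = record { rel = ∼ X ; isFunctional = id-functional X }

    _∙_ : ∀ {X Y Z} → Y ⇒ Z → X ⇒ Y → X ⇒ Z
    G ∙ F = record
      { rel          = compose (rel G) (rel F)
      ; isFunctional = ∘-functional (isFunctional G) (isFunctional F)
      }

    field
      ≈-isEquivalence : ∀ {X Y} → IsEquivalence (_≈_ {X} {Y})
      ∙-resp-≈  : ∀ {X Y Z} (F H : Y ⇒ Z) (G K : X ⇒ Y) →
                  F ≈ H → G ≈ K → (F ∙ G) ≈ (H ∙ K)
      identityˡ : ∀ {X Y} (F : X ⇒ Y) → (idₘ ∙ F) ≈ F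
      identityʳ : ∀ {X Y} (F : X ⇒ Y) → (F ∙ idₘ) ≈ F
      assoc     : ∀ {X Y Z W} (F : X ⇒ Y) (G : Y ⇒ Z) (H : Z ⇒ W) →
                  ((H ∙ G) ∙ F) ≈ (H ∙ (G ∙ F))

    category : Category (lsuc 0ℓ) 0ℓ 0ℓ
    category = record
      { Obj = PER
      ; _⇒_ = _⇒_
      ; _≈_ = _≈_
      ; idₘ = idₘ
      ; _∙_ = _∙_
      ; ≈-isEquivalence = ≈-isEquivalence
      ; ∙-resp-≈  = λ {_} {_} {_} {F} {H} {G} {K} → ∙-resp-≈ F H G K
      ; identityˡ = λ {_} {_} {F} → identityˡ F
      ; identityʳ = λ {_} {_} {F} → identityʳ F
      ; assoc     = λ {_} {_} {_} {_} {F} {G} {H} → assoc F G H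
      }

  YieldsTopos : Set₁
  YieldsTopos = Σ IsCategorical (λ c → IsTopos (IsCategorical.category c))

open TriposToTopos public using (YieldsTopos)

module _ (𝓘 : PureInstance) where
  open PureInstance 𝓘

  -- The sets ⌊ P ⌋ with P ⊆ 𝒫 and ⌊ P ⌋ ⊆ 𝒱.
  record Φ-ef : Set where
    field
      carrier   : Subset Λ
      isErasure : ∃[ P ] IsImage ⌊_⌋ P carrier
      ⊆-values  : ∀ {p} → p ∈ carrier → IsValue p

  open Φ-ef

  E-ef : Set
  E-ef = Λ

  _—[_]→_ : Φ-ef → E-ef → Φ-ef → Set
  φ₁ —[ e ]→ φ₂ = ∀ p₁ → p₁ ∈ carrier φ₁ → app e p₁ ∈ lift (carrier φ₂)

  effectPreorder : IndexedPreorder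
  effectPreorder = record
    { Pr   = λ I → I → Φ-ef
    ; _⊑_  = λ α β → ∃[ e ] (∀ i → α i —[ e ]→ β i)
    ; _^*_ = λ f α → α ∘ f
    }

{-# OPTIONS --safe #-}
module Submission where

open import Defs
open import Level using (0ℓ)
open import Axiom.ExcludedMiddle using (ExcludedMiddle)
open import Data.Empty using (⊥-elim)
open import Data.List.Base using (List; []; _∷_)
open import Data.Nat.Base using (zero; suc)
open import Data.Product.Base
  using (Σ-syntax; ∃-syntax; _×_; _,_; proj₁; proj₂; swap)
open import Data.Unit.Base using (tt) renaming (⊤ to Unit)
open import Function.Base using (id; _∘_)
open import Function.Bundles using (_⇔_; mk⇔)
open import Relation.Binary.Lattice.Structures using (IsHeytingAlgebra)
open import Relation.Binary.PropositionalEquality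
  using (_≡_; _≗_; refl; sym; trans; cong; cong₂)
open import Relation.Nullary.Decidable using (isYes; toWitness; fromWitness)

-- Call e a realizer of φ ⟶ ψ when e p ∈ lift ψ for all p ∈ φ.  The four laws of
-- the lifting are what call-by-value code with let needs in order to realize
-- identities, composites, pairs and projections, currying and evaluation.  As
-- the elements of φ are values, the existential along a map of sets is a plain
-- union with unchanged realizers, and Φ itself carries the generic predicate.
-- This gives a sound natural deduction calculus, in which the axioms of a tripos
-- and of the topos of partial equivalence relations are derived.  The topos
-- part rests on two remarks: functional relations F ⊑ G are isomorphic, and all
-- the maps into Ω and into exponentials that are needed are graphs of functions.

-- Renaming and substitution

liftʳ-id : ∀ {ρ} → ρ ≗ id → liftʳ ρ ≗ id
liftʳ-id h zero    = refl
liftʳ-id h (suc n) = cong suc (h n)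

rename-id : ∀ {ρ} → ρ ≗ id → rename ρ ≗ id
rename-id h (var n)    = cong var (h n)
rename-id h (lam p)    = cong lam (rename-id (liftʳ-id h) p)
rename-id h (app p q)  = cong₂ app (rename-id h p) (rename-id h q)
rename-id h (ret p)    = cong ret (rename-id h p)
rename-id h (let′ p q) = cong₂ let′ (rename-id h p) (rename-id (liftʳ-id h) q)
rename-id h (pair p q) = cong₂ pair (rename-id h p) (rename-id h q)
rename-id h (π₁ p)     = cong π₁ (rename-id h p)
rename-id h (π₂ p)     = cong π₂ (rename-id h p)

lift-factor : ∀ {σ ρ ρ′} → σ ∘ ρ ≗ var ∘ ρ′ →
              liftˢ σ ∘ liftʳ ρ ≗ var ∘ liftʳ ρ′
lift-factor h zero    = refl
lift-factor h (suc n) = cong (rename suc) (h n)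

-- Terms placed under the binders of a realizer are weakened, and on weakened terms the
-- substitutions of β-steps act as renamings; this case replaces a general substitution lemma.
subst-rename : ∀ {σ ρ ρ′} → σ ∘ ρ ≗ var ∘ ρ′ →
               subst σ ∘ rename ρ ≗ rename ρ′
subst-rename h (var n)    = h n
subst-rename h (lam p)    = cong lam (subst-rename (lift-factor h) p)
subst-rename h (app p q)  = cong₂ app (subst-rename h p) (subst-rename h q)
subst-rename h (ret p)    = cong ret (subst-rename h p)
subst-rename h (let′ p q) =
  cong₂ let′ (subst-rename h p) (subst-rename (lift-factor h) q)
subst-rename h (pair p q) = cong₂ pair (subst-rename h p) (subst-rename h q)
subst-rename h (π₁ p)     = cong π₁ (subst-rename h p)
subst-rename h (π₂ p)     = cong π₂ (subst-rename h p)

weaken-[] : ∀ p q → rename suc p [ q ] ≡ p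
weaken-[] p q = trans (subst-rename {ρ′ = id} (λ _ → refl) p)
                      (rename-id (λ _ → refl) p)

-- The shape left when a β-step substitutes for the outer of two variables: one of the two
-- weakenings survives.
weaken²-[] : ∀ p q →
             subst (liftˢ (single q)) (rename (suc ∘ suc) p) ≡ rename suc p
weaken²-[] p q = subst-rename (λ _ → refl) p

-- Surjectivity of erasure

annotate : ∀ t → ∃[ p ] ⌊ p ⌋ ≡ t
annotate (var n)    = var n , refl
-- Programs are raw, so any annotation will do; `tvar 0` is an arbitrary choice.
annotate (lam t)    with p , refl ← annotate t = lam (tvar 0) p , refl
annotate (app t u)  with p , refl ← annotate t | q , refl ← annotate u = app p q , refl
annotate (ret t)    with p , refl ← annotate t = ret p , refl
annotate (let′ t u) with p , refl ← annotate t | q , refl ← annotate u = let′ p q , refl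
annotate (pair t u) with p , refl ← annotate t | q , refl ← annotate u = pair p q , refl
annotate (π₁ t)     with p , refl ← annotate t = π₁ p , refl
annotate (π₂ t)     with p , refl ← annotate t = π₂ p , refl

-- The preimage of A under erasure works because `annotate` makes erasure surjective.
everySubsetIsErasure : ∀ A → ∃[ P ] IsImage ⌊_⌋ P A
everySubsetIsErasure A = A ∘ ⌊_⌋ , λ t → mk⇔
  (λ t∈A → let p , eq = annotate t in p , transport (sym eq) t∈A , eq)
  (λ (p , p∈ , eq) → transport eq p∈)
  where
  transport : ∀ {t u} → t ≡ u → t ∈ A → u ∈ A
  transport refl t∈A = t∈A

-- Propositions and realizers

module Realizability (em : ExcludedMiddle 0ℓ) (𝓘 : PureInstance) where
  open PureInstance 𝓘

  Φ : Set
  Φ = Φ-ef 𝓘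

  open Φ-ef

  infix 4 _⟶[_]_

  -- Opaque so that φ and ψ can be inferred from it.
  opaque
    _⟶[_]_ : Φ → Λ → Φ → Set
    φ ⟶[ e ] ψ = _—[_]→_ 𝓘 φ e ψ

    conceal : ∀ {φ e ψ} → _—[_]→_ 𝓘 φ e ψ → φ ⟶[ e ] ψ
    conceal r = r

    reveal : ∀ {φ e ψ} → φ ⟶[ e ] ψ → _—[_]→_ 𝓘 φ e ψ
    reveal r = r

  -- Deciding P by excluded middle keeps the result in the small set Φ even when P quantifies over
  -- Φ. This is the impredicativity behind `_∨_` and `Ω`.
  comprehend : (P : Λ → Set) → (∀ {p} → P p → IsValue p) → Φ
  comprehend P value = record
    { carrier   = λ p → isYes (em {P p})
    ; isErasure = everySubsetIsErasure _
    ; ⊆-values  = λ p∈ → value (toWitness p∈)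
    }

  infix 2 _⊃_
  infixr 7 _∧_

  opaque
    ⊤ : Φ
    ⊤ = comprehend IsValue id

    _∧_ : Φ → Φ → Φ
    φ ∧ ψ = comprehend
      (λ p → ∃[ v ] ∃[ w ] (v ∈ carrier φ × w ∈ carrier ψ × p ≡ pair v w))
      λ { (_ , _ , v∈ , w∈ , refl) → pair (⊆-values φ v∈) (⊆-values ψ w∈) }

    ⨆ : {X : Set} → (X → Φ) → Φ
    ⨆ φ = comprehend (λ p → ∃[ x ] p ∈ carrier (φ x))
                     (λ (x , p∈) → ⊆-values (φ x) p∈)

    -- ⨅ x. φ x ⇒ ψ x.  Since lift need not commute with intersections, a bare
    -- intersection has no introduction rule; waiting for an argument makes
    -- the realizer a value, to which lift-ret applies uniformly in x.
    _⊃_ : {X : Set} → (X → Φ) → (X → Φ) → Φ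
    φ ⊃ ψ = comprehend
      (λ p → IsValue p × (∀ x v → v ∈ carrier (φ x) → app p v ∈ lift (carrier (ψ x))))
      proj₁

  -- In `lift-⇝` variable 0 marks the hole of the context. Here the context is the hole alone; in
  -- the next two lemmas the other subterm is weakened so that filling the hole leaves it unchanged.
  lift-β : ∀ {A v} b → IsValue v → b [ v ] ∈ lift A → app (lam b) v ∈ lift A
  lift-β b val = lift-⇝ (var 0) (⇝-β val)

  lift-appˡ : ∀ {A p p′ q} → p ⇝ p′ → app p′ q ∈ lift A → app p q ∈ lift A
  lift-appˡ {A} {p} {p′} {q} r
    with f ← lift-⇝ {A} (app (var 0) (rename suc q)) r
    rewrite weaken-[] q p | weaken-[] q p′ = f

  lift-appʳ : ∀ {A p q q′} → q ⇝ q′ → app p q′ ∈ lift A → app p q ∈ lift A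
  lift-appʳ {A} {p} {q} {q′} r
    with f ← lift-⇝ {A} (app (rename suc p) (var 0)) r
    rewrite weaken-[] p q | weaken-[] p q′ = f

  infixr 9 _·_

  opaque
    unfolding _⟶[_]_ _∧_

    idᵉ fstᵉ sndᵉ evalᵉ : Λ
    idᵉ   = lam (ret (var 0))
    fstᵉ  = lam (ret (π₁ (var 0)))
    sndᵉ  = lam (ret (π₂ (var 0)))
    evalᵉ = lam (app (π₁ (var 0)) (π₂ (var 0)))

    -- Kleisli composition and pairing, sequenced by `let′`. The arguments may be open and are
    -- therefore weakened past each binder.
    _·_ ⟨_,_⟩ᵉ : Λ → Λ → Λ
    g · f = lam (let′ (app (rename suc f) (var 0))
                      (app (rename (suc ∘ suc) g) (var 0)))
    ⟨ f , g ⟩ᵉ = lam (let′ (app (rename suc f) (var 0))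
                     (let′ (app (rename (suc ∘ suc) g) (var 1))
                           (ret (pair (var 1) (var 0)))))

    curryᵉ : Λ → Λ
    curryᵉ f = lam (ret (lam (app (rename (suc ∘ suc) f) (pair (var 1) (var 0)))))

    id-realizes : ∀ {φ} → φ ⟶[ idᵉ ] φ
    id-realizes {φ} v v∈ = lift-β (ret (var 0)) (⊆-values φ v∈) (lift-ret v∈)

    ⊤-realizes : ∀ {φ} → φ ⟶[ idᵉ ] ⊤
    ⊤-realizes {φ} v v∈ =
      let val = ⊆-values φ v∈ in
      lift-β (ret (var 0)) val (lift-ret (fromWitness val))

    ·-realizes : ∀ {φ ψ χ f g} → ψ ⟶[ g ] χ → φ ⟶[ f ] ψ → φ ⟶[ g · f ] χ
    ·-realizes {φ} {ψ} {χ} {f} {g} G F v v∈ = lift-β _ (⊆-values φ v∈) step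
      where
      step : let′ (app (rename suc f [ v ]) v)
                  (app (subst (liftˢ (single v)) (rename (suc ∘ suc) g)) (var 0))
             ∈ lift (carrier χ)
      step rewrite weaken-[] f v | weaken²-[] g v =
        -- Monotonicity enlarges ψ to the set of those x on which the continuation succeeds, which
        -- is the premise of `lift-let`.
        lift-let {carrier χ} (lift-mono {carrier ψ} (λ {x} → run {x}) (F v v∈))
        where
        run : ∀ {x} → x ∈ carrier ψ → app (rename suc g [ x ]) x ∈ lift (carrier χ)
        run {x} x∈ rewrite weaken-[] g x = G x x∈

    pair-realizes : ∀ {φ ψ χ f g} → φ ⟶[ f ] ψ → φ ⟶[ g ] χ →
                    φ ⟶[ ⟨ f , g ⟩ᵉ ] ψ ∧ χ
    pair-realizes {φ} {ψ} {χ} {f} {g} F G v v∈ = lift-β _ (⊆-values φ v∈) step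
      where
      step : let′ (app (rename suc f [ v ]) v)
             (let′ (app (subst (liftˢ (single v)) (rename (suc ∘ suc) g)) (rename suc v))
                   (ret (pair (var 1) (var 0))))
             ∈ lift (carrier (ψ ∧ χ))
      step rewrite weaken-[] f v | weaken²-[] g v =
        lift-let {carrier (ψ ∧ χ)} (lift-mono {carrier ψ} (λ {x} → run {x}) (F v v∈))
        where
        run : ∀ {x} → x ∈ carrier ψ →
              let′ (app (rename suc g [ x ]) (rename suc v [ x ]))
                   (ret (pair (rename suc x) (var 0)))
              ∈ lift (carrier (ψ ∧ χ))
        run {x} x∈ rewrite weaken-[] g x | weaken-[] v x =
          lift-let {carrier (ψ ∧ χ)} (lift-mono {carrier χ} (λ {y} → run′ {y}) (G v v∈))
          where
          run′ : ∀ {y} → y ∈ carrier χ →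
                 ret (pair (rename suc x [ y ]) y) ∈ lift (carrier (ψ ∧ χ))
          run′ {y} y∈ rewrite weaken-[] x y =
            lift-ret (fromWitness (_ , _ , x∈ , y∈ , refl))

    fst-realizes : ∀ {φ ψ} → φ ∧ ψ ⟶[ fstᵉ ] φ
    fst-realizes {φ} {ψ} p p∈ with v , w , v∈ , w∈ , refl ← toWitness p∈ =
      let v-val = ⊆-values φ v∈ ; w-val = ⊆-values ψ w∈ in
      lift-β (ret (π₁ (var 0))) (pair v-val w-val)
        -- The reduction law holds in every context, so the projection is evaluated under `ret`.
        (lift-⇝ (ret (var 0)) (⇝-π₁ v-val w-val) (lift-ret v∈))

    snd-realizes : ∀ {φ ψ} → φ ∧ ψ ⟶[ sndᵉ ] ψ
    snd-realizes {φ} {ψ} p p∈ with v , w , v∈ , w∈ , refl ← toWitness p∈ =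
      let v-val = ⊆-values φ v∈ ; w-val = ⊆-values ψ w∈ in
      lift-β (ret (π₂ (var 0))) (pair v-val w-val)
        (lift-⇝ (ret (var 0)) (⇝-π₂ v-val w-val) (lift-ret w∈))

    curry-realizes : ∀ {X : Set} {φ} {ψ χ : X → Φ} {f} →
                     (∀ x → φ ∧ ψ x ⟶[ f ] χ x) → φ ⟶[ curryᵉ f ] (ψ ⊃ χ)
    curry-realizes {φ = φ} {ψ} {χ} {f} F v v∈ =
      lift-β _ (⊆-values φ v∈) (lift-ret (fromWitness (lam _ , run)))
      where
      run : ∀ x w → w ∈ carrier (ψ x) →
            app (lam (app (subst (liftˢ (single v)) (rename (suc ∘ suc) f))
                          (pair (rename suc v) (var 0)))) w
            ∈ lift (carrier (χ x))
      run x w w∈ = lift-β _ (⊆-values (ψ x) w∈) run′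
        where
        run′ : app (subst (liftˢ (single v)) (rename (suc ∘ suc) f) [ w ])
                   (pair (rename suc v [ w ]) w)
               ∈ lift (carrier (χ x))
        run′ rewrite weaken²-[] f v | weaken-[] f w | weaken-[] v w =
          F x _ (fromWitness (_ , _ , v∈ , w∈ , refl))

    eval-realizes : ∀ {X : Set} {φ ψ : X → Φ} x → (φ ⊃ ψ) ∧ φ x ⟶[ evalᵉ ] ψ x
    eval-realizes {φ = φ} x p p∈ with v , w , v∈ , w∈ , refl ← toWitness p∈ =
      let v-val , run = toWitness v∈ ; w-val = ⊆-values (φ x) w∈ in
      lift-β (app (π₁ (var 0)) (π₂ (var 0))) (pair v-val w-val)
        (lift-appˡ (⇝-π₁ v-val w-val)
          (lift-appʳ (⇝-π₂ v-val w-val) (run x w w∈)))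

    ⨆-intro-realizes : ∀ {X : Set} {φ : X → Φ} x → φ x ⟶[ idᵉ ] ⨆ φ
    ⨆-intro-realizes {φ = φ} x v v∈ =
      lift-β (ret (var 0)) (⊆-values (φ x) v∈) (lift-ret (fromWitness (x , v∈)))

    ⨆-elim-realizes : ∀ {X : Set} {φ : X → Φ} {ψ e} →
                      (∀ x → φ x ⟶[ e ] ψ) → ⨆ φ ⟶[ e ] ψ
    ⨆-elim-realizes h v v∈ = let x , v∈φ = toWitness v∈ in h x v v∈φ

-- Natural deduction with uniform realizers

module Logic (em : ExcludedMiddle 0ℓ) (𝓘 : PureInstance) where
  open Realizability em 𝓘 public

  ⋀ : List Φ → Φ
  ⋀ []      = ⊤
  ⋀ (φ ∷ Γ) = φ ∧ ⋀ Γ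

  infix 3 _⊢[_]_

  -- An entailment between predicates on a set I is a family, indexed by i : I,
  -- of derivations whose realizer e does not depend on i.  The rules determine
  -- e, so it is left to unification, which checks this uniformity.
  record _⊢[_]_ (Γ : List Φ) (e : Λ) (φ : Φ) : Set where
    constructor realize
    field realizes : ⋀ Γ ⟶[ e ] φ
  open _⊢[_]_

  private variable
    X       : Set
    Γ       : List Φ
    c d e   : Λ
    φ ψ χ   : Φ
    α β     : X → Φ

  code : Γ ⊢[ e ] φ → Λ
  code {e = e} _ = e

  h₀ : φ ∷ Γ ⊢[ fstᵉ ] φ
  h₀ = realize fst-realizes

  weaken : Γ ⊢[ e ] φ → ψ ∷ Γ ⊢[ e · sndᵉ ] φ
  weaken (realize E) = realize (·-realizes E snd-realizes)

  cut : Γ ⊢[ d ] φ → φ ∷ Γ ⊢[ e ] ψ → Γ ⊢[ e · ⟨ d , idᵉ ⟩ᵉ ] ψ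
  cut (realize D) (realize E) =
    realize (·-realizes E (pair-realizes D id-realizes))

  ⊤-intro : Γ ⊢[ idᵉ ] ⊤
  ⊤-intro = realize ⊤-realizes

  ∧-intro : Γ ⊢[ d ] φ → Γ ⊢[ e ] ψ → Γ ⊢[ ⟨ d , e ⟩ᵉ ] φ ∧ ψ
  ∧-intro (realize D) (realize E) = realize (pair-realizes D E)

  ∧-elimˡ : Γ ⊢[ e ] φ ∧ ψ → Γ ⊢[ fstᵉ · e ] φ
  ∧-elimˡ (realize E) = realize (·-realizes fst-realizes E)

  ∧-elimʳ : Γ ⊢[ e ] φ ∧ ψ → Γ ⊢[ sndᵉ · e ] ψ
  ∧-elimʳ (realize E) = realize (·-realizes snd-realizes E)

  ⊃-intro : (∀ x → α x ∷ Γ ⊢[ e ] β x) → Γ ⊢[ curryᵉ (e · ⟨ sndᵉ , fstᵉ ⟩ᵉ) ] (α ⊃ β)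
  ⊃-intro E = realize (curry-realizes λ x →
    -- `curry-realizes` supplies the new argument as second component, whereas the new hypothesis
    -- heads the context; hence the swap.
    ·-realizes (realizes (E x)) (pair-realizes snd-realizes fst-realizes))

  ⊃-elim : ∀ x → Γ ⊢[ d ] (α ⊃ β) → Γ ⊢[ e ] α x → Γ ⊢[ evalᵉ · ⟨ d , e ⟩ᵉ ] β x
  ⊃-elim x (realize D) (realize E) =
    realize (·-realizes (eval-realizes x) (pair-realizes D E))

  ⨆-intro : ∀ x → Γ ⊢[ e ] α x → Γ ⊢[ idᵉ · e ] ⨆ α
  ⨆-intro x (realize E) = realize (·-realizes (⨆-intro-realizes x) E)

  -- A union can only be split when it is the whole antecedent, hence Γ is
  -- moved to the right of ⊃ in the meantime.
  ⨆-elim : Γ ⊢[ d ] ⨆ α → (∀ x → α x ∷ Γ ⊢[ e ] ψ) → Γ ⊢[ _ ] ψ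
  ⨆-elim {Γ = Γ} {α = α} {ψ = ψ} (realize D) E = realize (·-realizes
    (eval-realizes {φ = λ _ → ⋀ Γ} {ψ = λ _ → ψ} tt)
    (pair-realizes
      (·-realizes (⨆-elim-realizes λ x → curry-realizes λ _ → realizes (E x)) D)
      id-realizes))

  module _ (α β : X → Φ) where
    open IndexedPreorder (effectPreorder 𝓘) using (_⊑_)

    entails : (∀ x → α x ∷ [] ⊢[ e ] β x) → α ⊑ β
    entails E = _ , λ x → reveal
      -- The one-element context stands for α x ∧ ⊤, so the realizer of α x is first paired with one
      -- of ⊤.
      (·-realizes (realizes (E x)) (pair-realizes id-realizes ⊤-realizes))

    apply : (r : α ⊑ β) → ∀ x → Γ ⊢[ e ] α x → Γ ⊢[ proj₁ r · e ] β x
    apply r x (realize E) = realize (·-realizes (conceal (proj₂ r x)) E)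

  h₁ : ∀ {ψ} → ψ ∷ φ ∷ Γ ⊢[ _ ] φ
  h₁ = weaken h₀

  h₂ : ∀ {ψ χ} → ψ ∷ χ ∷ φ ∷ Γ ⊢[ _ ] φ
  h₂ = weaken h₁

  h₃ : ∀ {ψ χ θ} → ψ ∷ χ ∷ θ ∷ φ ∷ Γ ⊢[ _ ] φ
  h₃ = weaken h₂

  h₄ : ∀ {ψ χ θ θ′} → ψ ∷ χ ∷ θ ∷ θ′ ∷ φ ∷ Γ ⊢[ _ ] φ
  h₄ = weaken h₃

  tail : φ ∷ Γ ⊢[ sndᵉ ] ⋀ Γ
  tail = realize snd-realizes

  multicut : ∀ {Δ} → Γ ⊢[ d ] ⋀ Δ → Δ ⊢[ e ] φ → Γ ⊢[ e · d ] φ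
  multicut (realize D) (realize E) = realize (·-realizes E D)

  lemma : φ ∷ [] ⊢[ e ] ψ → Γ ⊢[ d ] φ → Γ ⊢[ _ ] ψ
  lemma E D = multicut (∧-intro D ⊤-intro) E

  lemma₂ : φ ∷ ψ ∷ [] ⊢[ c ] χ → Γ ⊢[ d ] φ → Γ ⊢[ e ] ψ → Γ ⊢[ _ ] χ
  lemma₂ C D E = multicut (∧-intro D (∧-intro E ⊤-intro)) C

  ∧-elim-head : φ ∷ ψ ∷ Γ ⊢[ e ] χ → φ ∧ ψ ∷ Γ ⊢[ _ ] χ
  ∧-elim-head E =
    multicut (∧-intro (∧-elimˡ h₀) (∧-intro (∧-elimʳ h₀) tail)) E

  ∧-elim-head₃ : ∀ {θ} → φ ∷ ψ ∷ χ ∷ Γ ⊢[ e ] θ → φ ∧ ψ ∧ χ ∷ Γ ⊢[ _ ] θ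
  ∧-elim-head₃ E = multicut (∧-intro (∧-elimˡ h₀)
    (∧-intro (∧-elimˡ (∧-elimʳ h₀)) (∧-intro (∧-elimʳ (∧-elimʳ h₀)) tail))) E

  infixr 5 _⟹_
  infixr 6 _∨_

  _⟹_ : Φ → Φ → Φ
  φ ⟹ ψ = (λ (_ : Unit) → φ) ⊃ (λ _ → ψ)

  ⟹-intro : φ ∷ Γ ⊢[ e ] ψ → Γ ⊢[ _ ] φ ⟹ ψ
  ⟹-intro E = ⊃-intro λ _ → E

  ⟹-elim : Γ ⊢[ d ] φ ⟹ ψ → Γ ⊢[ e ] φ → Γ ⊢[ _ ] ψ
  ⟹-elim D E = ⊃-elim tt D E

  -- The second-order encoding, with the quantifier ranging over all of Φ.
  _∨_ : Φ → Φ → Φ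
  φ ∨ ψ = (λ χ → (φ ⟹ χ) ∧ (ψ ⟹ χ)) ⊃ id

  ⨅ : {X : Set} → (X → Φ) → Φ
  ⨅ α = (λ _ → ⊤) ⊃ α

-- The tripos

module Tripos (em : ExcludedMiddle 0ℓ) (𝓘 : PureInstance) where
  open Logic em 𝓘
  open IndexedPreorder (effectPreorder 𝓘)

  ⊑-refl : ∀ {I} (α : Pr I) → α ⊑ α
  ⊑-refl α = entails α α λ _ → h₀

  ⊑-trans : ∀ {I} (α β γ : Pr I) → α ⊑ β → β ⊑ γ → α ⊑ γ
  ⊑-trans α β γ r s =
    entails α γ λ i → apply β γ s i (apply α β r i h₀)

  ≅-refl : ∀ {I} (α : Pr I) → α ≅ α
  ≅-refl α = ⊑-refl α , ⊑-refl α

  𝟏 𝟎 : ∀ {I} → Pr I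
  𝟏 _ = ⊤
  𝟎 _ = ⨆ ⊥-elim

  _⊓_ _⊔_ _⇛_ : ∀ {I} → Pr I → Pr I → Pr I
  (α ⊓ β) i = α i ∧ β i
  (α ⊔ β) i = α i ∨ β i
  (α ⇛ β) i = α i ⟹ β i

  isHeyting : ∀ {I} → IsHeytingAlgebra (_≅_ {I}) _⊑_ _⊔_ _⊓_ _⇛_ 𝟏 𝟎
  isHeyting = record
    { isBoundedLattice = record
      { isLattice = record
        { isPartialOrder = record
          { isPreorder = record
            { isEquivalence = record
              { refl  = λ {α} → ≅-refl α
              ; sym   = swap
              ; trans = λ {α} {β} {γ} (r , r′) (s , s′) →
                  ⊑-trans α β γ r s , ⊑-trans γ β α s′ r′
              }
            ; reflexive = proj₁
            ; trans     = λ {α} {β} {γ} → ⊑-trans α β γ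
            }
          ; antisym = _,_
          }
        ; supremum = λ α β →
            (entails α (α ⊔ β) λ i → ⊃-intro λ χ → ⟹-elim (∧-elimˡ h₀) h₁) ,
            (entails β (α ⊔ β) λ i → ⊃-intro λ χ → ⟹-elim (∧-elimʳ h₀) h₁) ,
            λ γ r s → entails (α ⊔ β) γ λ i → ⊃-elim (γ i) h₀ (∧-intro
              (⟹-intro (apply α γ r i h₀))
              (⟹-intro (apply β γ s i h₀)))
        ; infimum = λ α β →
            (entails (α ⊓ β) α λ i → ∧-elimˡ h₀) ,
            (entails (α ⊓ β) β λ i → ∧-elimʳ h₀) ,
            λ γ r s → entails γ (α ⊓ β) λ i →
              ∧-intro (apply γ α r i h₀) (apply γ β s i h₀)
        }
      ; maximum = λ α → entails α 𝟏 λ i → ⊤-intro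
      -- No branch of the empty union determines a realizer, so an arbitrary one is named.
      ; minimum = λ α → entails 𝟎 α λ i → ⨆-elim {e = idᵉ} h₀ λ ()
      }
    ; exponential = λ α β γ →
        (λ r → entails α (β ⇛ γ) λ i → ⟹-intro
          (apply (α ⊓ β) γ r i (∧-intro h₁ h₀))) ,
        (λ r → entails (α ⊓ β) γ λ i → ⟹-elim
          (apply α (β ⇛ γ) r i (∧-elimˡ h₀)) (∧-elimʳ h₀))
    }

  ∐ ∏ : ∀ {I J} → (I → J) → Pr I → Pr J
  ∐ f α j = ⨆ {Σ[ i ∈ _ ] f i ≡ j} (α ∘ proj₁)
  ∏ f α j = ⨅ {Σ[ i ∈ _ ] f i ≡ j} (α ∘ proj₁)

  ∐⊣^* : ∀ {I J} (f : I → J) α β → (∐ f α ⊑ β) ⇔ (α ⊑ f ^* β)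
  ∐⊣^* f α β = mk⇔
    (λ r → entails α (f ^* β) λ i → apply (∐ f α) β r (f i) (⨆-intro (i , refl) h₀))
    (λ r → entails (∐ f α) β λ j → ⨆-elim h₀
      λ { (i , refl) → apply α (f ^* β) r i h₀ })

  ^*⊣∏ : ∀ {I J} (f : I → J) β α → (f ^* β ⊑ α) ⇔ (β ⊑ ∏ f α)
  ^*⊣∏ f β α = mk⇔
    (λ r → entails β (∏ f α) λ j → ⊃-intro
      λ { (i , refl) → apply (f ^* β) α r i h₁ })
    (λ r → entails (f ^* β) α λ i →
      ⊃-elim (i , refl) (apply β (∏ f α) r (f i) h₀) ⊤-intro)

  module _ {P I J K} {p : P → I} {q : P → J} {f : I → K} {g : J → K}
           (square : IsPullbackSquare p q f g) (α : Pr I) where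

    -- Both sides are unions over fibres. A point of the fibre of f over g j lifts through the
    -- square to the fibre of q over j, and p maps the latter back; α has the same value at both, so
    -- realizers are unaffected.
    ∐-beckChevalley : g ^* ∐ f α ≅ ∐ q (p ^* α)
    ∐-beckChevalley =
      (entails (g ^* ∐ f α) (∐ q (p ^* α)) λ j → ⨆-elim h₀
        λ (i , fi≡gj) → fill i j fi≡gj) ,
      (entails (∐ q (p ^* α)) (g ^* ∐ f α) λ j → ⨆-elim h₀
        λ { (x , refl) → ⨆-intro (p x , proj₁ square x) h₀ })
      where
      fill : ∀ {Γ} i j → f i ≡ g j → α i ∷ Γ ⊢[ _ ] ∐ q (p ^* α) j
      fill i j eq with x , (refl , refl) , _ ← proj₂ square i j eq =
        ⨆-intro (x , refl) h₀

    ∏-beckChevalley : g ^* ∏ f α ≅ ∏ q (p ^* α)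
    ∏-beckChevalley =
      (entails (g ^* ∏ f α) (∏ q (p ^* α)) λ j → ⊃-intro
        λ { (x , refl) → ⊃-elim (p x , proj₁ square x) h₁ ⊤-intro }) ,
      (entails (∏ q (p ^* α)) (g ^* ∏ f α) λ j → ⊃-intro
        λ (i , fi≡gj) → fill i j fi≡gj)
      where
      fill : ∀ {Γ φ} i j → f i ≡ g j → φ ∷ ∏ q (p ^* α) j ∷ Γ ⊢[ _ ] α i
      fill i j eq with x , (refl , refl) , _ ← proj₂ square i j eq =
        ⊃-elim (x , refl) h₁ ⊤-intro

  isTripos : IsTripos (effectPreorder 𝓘)
  isTripos = record
    { ⊤ = 𝟏
    ; ⊥ = 𝟎
    ; _∧_ = _⊓_
    ; _∨_ = _⊔_
    ; _⇨_ = _⇛_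
    ; isHeyting = isHeyting
    ; ^*-mono = λ f (e , r) → e , λ i → r (f i)
    ; ^*-⊤ = λ f → ≅-refl 𝟏
    ; ^*-⊥ = λ f → ≅-refl 𝟎
    ; ^*-∧ = λ f α β → ≅-refl (f ^* (α ⊓ β))
    ; ^*-∨ = λ f α β → ≅-refl (f ^* (α ⊔ β))
    ; ^*-⇨ = λ f α β → ≅-refl (f ^* (α ⇛ β))
    ; ^*-id = λ α → refl
    ; ^*-∘ = λ g f α → refl
    ; ^*-cong = λ {f = f} {g} eq α →
        
        entails (f ^* α) (g ^* α) (λ i → along α (eq i)) ,
        entails (g ^* α) (f ^* α) (λ i → along α (sym (eq i)))
    ; ∐ = ∐
    ; ∏ = ∏
    ; ∐⊣^* = ∐⊣^*
    ; ^*⊣∏ = ^*⊣∏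
    ; ∐-beckChevalley = ∐-beckChevalley
    ; ∏-beckChevalley = ∏-beckChevalley
    ; Props = Φ
    ; tr = id
    ; classify = id
    ; classifies = ≅-refl
    }
    where
    along : ∀ {J Γ} (α : Pr J) {j j′} → j ≡ j′ → α j ∷ Γ ⊢[ _ ] α j′
    along α refl = h₀

-- Partial equivalence relations and internal functionality

module FunctionalRelations (em : ExcludedMiddle 0ℓ) (𝓘 : PureInstance) where
  open Logic em 𝓘
  open Tripos em 𝓘
  open IndexedPreorder (effectPreorder 𝓘)
  open TriposToTopos isTripos
  open IsFunctional

  private variable
    A         : Set
    X Y       : PER
    Γ         : List Φ
    a b c d e : Λ

  -- Proofs of IsPER and IsFunctional are opaque from here on: the realizers
  -- they contain occur in the types of later derivations, where unfolding
  -- them is prohibitively expensive.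
  record IsPER (R : Pr (A × A)) : Set where
    field
      ∼-sym   : R ⊑ swap ^* R
      ∼-trans : (λ (x , y , z) → R (x , y) ∧ R (y , z)) ⊑
                (λ ((x , y , z) : A × A × A) → R (x , z))

  isPER : ∀ {R : Pr (A × A)} →
          (∀ x y → R (x , y) ∷ [] ⊢[ d ] R (y , x)) →
          (∀ x y z → R (x , y) ∷ R (y , z) ∷ [] ⊢[ e ] R (x , z)) → IsPER R
  isPER {R = R} symm tran = record
    { ∼-sym   = entails R (swap ^* R) λ (x , y) → symm x y
    ; ∼-trans = entails (λ (x , y , z) → R (x , y) ∧ R (y , z))
        (λ (x , y , z) → R (x , z)) λ (x , y , z) → ∧-elim-head (tran x y z)
    }

  per : (A : Set) (R : Pr (A × A)) → IsPER R → PER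
  per A R r = record { ∣_∣ = A ; ∼ = R ; IsPER r }

  opaque
    symᵉ transᵉ : PER → Λ
    symᵉ X   = proj₁ (∼-sym X)
    transᵉ X = proj₁ (∼-trans X)

    symmetric : ∀ X {x y} → Γ ⊢[ e ] ∼ X (x , y) → Γ ⊢[ symᵉ X · e ] ∼ X (y , x)
    symmetric X {x} {y} = apply (∼ X) (swap ^* ∼ X) (∼-sym X) (x , y)

    transitive : ∀ X {x y z} → Γ ⊢[ d ] ∼ X (x , y) → Γ ⊢[ e ] ∼ X (y , z) →
                 Γ ⊢[ transᵉ X · ⟨ d , e ⟩ᵉ ] ∼ X (x , z)
    transitive X {x} {y} {z} D E =
      apply (λ (x , y , z) → ∼ X (x , y) ∧ ∼ X (y , z)) (λ (x , y , z) → ∼ X (x , z))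
            (∼-trans X) (x , y , z) (∧-intro D E)

  reflexiveˡ : ∀ X {x y} → Γ ⊢[ e ] ∼ X (x , y) → Γ ⊢[ _ ] ∼ X (x , x)
  reflexiveˡ X E = transitive X E (symmetric X E)

  reflexiveʳ : ∀ X {x y} → Γ ⊢[ e ] ∼ X (x , y) → Γ ⊢[ _ ] ∼ X (y , y)
  reflexiveʳ X E = transitive X (symmetric X E) E

  -- The conditions of `IsFunctional` as a single proposition of the logic, so that functionality
  -- can be a hypothesis and can carve out the elements of an exponential.
  Functionality : (X Y : PER) → Pr (∣ X ∣ × ∣ Y ∣) → Φ
  Functionality X Y F =
      (F ⊃ λ (x , y) → ∼ X (x , x) ∧ ∼ Y (y , y))
    ∧ ((λ ((x , x′ , y , y′) : ∣ X ∣ × ∣ X ∣ × ∣ Y ∣ × ∣ Y ∣) →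
          F (x , y) ∧ ∼ X (x , x′) ∧ ∼ Y (y , y′))
        ⊃ λ (x , x′ , y , y′) → F (x′ , y′))
    ∧ ((λ ((x , y , y′) : ∣ X ∣ × ∣ Y ∣ × ∣ Y ∣) → F (x , y) ∧ F (x , y′))
        ⊃ λ (x , y , y′) → ∼ Y (y , y′))
    ∧ ((λ x → ∼ X (x , x)) ⊃ λ x → ⨆ λ y → F (x , y))

  opaque
    -- Opaque so that X, Y and F can be inferred from a derivation of functionality.
    Functional : (X Y : PER) → Pr (∣ X ∣ × ∣ Y ∣) → Φ
    Functional = Functionality

    fold : ∀ {F} → Γ ⊢[ e ] Functionality X Y F → Γ ⊢[ e ] Functional X Y F
    fold E = E

    unfold : ∀ {F} → Γ ⊢[ e ] Functional X Y F → Γ ⊢[ e ] Functionality X Y F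
    unfold E = E

  functional-intro : ∀ {F} →
    (∀ x y → F (x , y) ∷ Γ ⊢[ a ] ∼ X (x , x)) →
    (∀ x y → F (x , y) ∷ Γ ⊢[ b ] ∼ Y (y , y)) →
    (∀ x x′ y y′ → F (x , y) ∷ ∼ X (x , x′) ∷ ∼ Y (y , y′) ∷ Γ ⊢[ c ] F (x′ , y′)) →
    (∀ x y y′ → F (x , y) ∷ F (x , y′) ∷ Γ ⊢[ d ] ∼ Y (y , y′)) →
    (∀ x → ∼ X (x , x) ∷ Γ ⊢[ e ] ⨆ λ y → F (x , y)) →
    Γ ⊢[ _ ] Functional X Y F
  functional-intro {X = X} {Y = Y} {F = F} sˡ sʳ ex sv tot = fold {X = X} {Y} {F} (∧-intro
    (⊃-intro λ (x , y) → ∧-intro (sˡ x y) (sʳ x y)) (∧-intro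
    (⊃-intro λ (x , x′ , y , y′) → ∧-elim-head₃ (ex x x′ y y′)) (∧-intro
    (⊃-intro λ (x , y , y′) → ∧-elim-head (sv x y y′))
    (⊃-intro tot))))

  module _ {F} (D : Γ ⊢[ d ] Functional X Y F) where

    strictˡ : ∀ {x y} → Γ ⊢[ e ] F (x , y) → Γ ⊢[ _ ] ∼ X (x , x)
    strictˡ E = ∧-elimˡ (⊃-elim _ (∧-elimˡ (unfold D)) E)

    strictʳ : ∀ {x y} → Γ ⊢[ e ] F (x , y) → Γ ⊢[ _ ] ∼ Y (y , y)
    strictʳ E = ∧-elimʳ (⊃-elim _ (∧-elimˡ (unfold D)) E)

    extend : ∀ {x x′ y y′} → Γ ⊢[ a ] F (x , y) → Γ ⊢[ b ] ∼ X (x , x′) →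
             Γ ⊢[ c ] ∼ Y (y , y′) → Γ ⊢[ _ ] F (x′ , y′)
    extend {x = x} {x′} {y} {y′} P Q R =
      ⊃-elim (x , x′ , y , y′) (∧-elimˡ (∧-elimʳ (unfold D))) (∧-intro P (∧-intro Q R))

    extendˡ : ∀ {x x′ y} → Γ ⊢[ a ] F (x , y) → Γ ⊢[ b ] ∼ X (x , x′) →
              Γ ⊢[ _ ] F (x′ , y)
    extendˡ P Q = extend P Q (strictʳ P)

    extendʳ : ∀ {x y y′} → Γ ⊢[ a ] F (x , y) → Γ ⊢[ b ] ∼ Y (y , y′) →
              Γ ⊢[ _ ] F (x , y′)
    extendʳ P Q = extend P (strictˡ P) Q

    unique : ∀ {x y y′} → Γ ⊢[ a ] F (x , y) → Γ ⊢[ b ] F (x , y′) →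
             Γ ⊢[ _ ] ∼ Y (y , y′)
    unique {x = x} {y} {y′} P Q =
      ⊃-elim (x , y , y′) (∧-elimˡ (∧-elimʳ (∧-elimʳ (unfold D)))) (∧-intro P Q)

    defined : ∀ {x} → Γ ⊢[ e ] ∼ X (x , x) → Γ ⊢[ _ ] ⨆ λ y → F (x , y)
    defined E = ⊃-elim _ (∧-elimʳ (∧-elimʳ (∧-elimʳ (unfold D)))) E

  module _ {X Y} {F : Pr (∣ X ∣ × ∣ Y ∣)} where

    -- A derivation without hypotheses has one realizer for all points, as the external entailments
    -- demand; `internalization` turns each such entailment back into an implication.
    externalize : [] ⊢[ d ] Functional X Y F → IsFunctional X Y F
    externalize D = record
      { strict       = entails F _ λ _ →
          ∧-intro (strictˡ (weaken D) h₀) (strictʳ (weaken D) h₀)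
      ; extensional  = entails _ (λ (x , x′ , y , y′) → F (x′ , y′))
          λ (x , x′ , y , y′) → ∧-elim-head₃
            (extend (weaken (weaken (weaken D))) h₀ h₁ h₂)
      ; singleValued = entails _ (λ (x , y , y′) → ∼ Y (y , y′))
          λ (x , y , y′) → ∧-elim-head (unique (weaken (weaken D)) h₀ h₁)
      ; total        = entails (λ x → ∼ X (x , x)) (∐ proj₁ F) λ x →
          ⨆-elim (defined (weaken D) h₀) λ y → ⨆-intro ((x , y) , refl) h₀
      }

    internalization : (isF : IsFunctional X Y F) → Γ ⊢[ _ ] Functional X Y F
    internalization isF = functional-intro
      (λ x y → ∧-elimˡ (strict′ h₀))
      (λ x y → ∧-elimʳ (strict′ h₀))
      (λ x x′ y y′ → apply
        (λ (x , x′ , y , y′) → F (x , y) ∧ ∼ X (x , x′) ∧ ∼ Y (y , y′))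
        (λ (x , x′ , y , y′) → F (x′ , y′)) (extensional isF)
        (x , x′ , y , y′) (∧-intro h₀ (∧-intro h₁ h₂)))
      (λ x y y′ → apply
        (λ (x , y , y′) → F (x , y) ∧ F (x , y′)) (λ (x , y , y′) → ∼ Y (y , y′))
        (singleValued isF) (x , y , y′) (∧-intro h₀ h₁))
      (λ x → ⨆-elim (apply (λ x → ∼ X (x , x)) (∐ proj₁ F) (total isF) x h₀)
        λ { ((_ , y) , refl) → ⨆-intro y h₀ })
      where
      strict′ : ∀ {Γ e x y} → Γ ⊢[ e ] F (x , y) →
                Γ ⊢[ _ ] ∼ X (x , x) ∧ ∼ Y (y , y)
      strict′ = apply F (λ (x , y) → ∼ X (x , x) ∧ ∼ Y (y , y)) (strict isF) _

    opaque
      -- Read off in the empty context, but valid for every Γ, since the code of `internalization`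
      -- does not depend on the context.
      internalᵉ : IsFunctional X Y F → Λ
      internalᵉ isF = code (internalization {Γ = []} isF)

      internalize : (isF : IsFunctional X Y F) → Γ ⊢[ internalᵉ isF ] Functional X Y F
      internalize = internalization

-- The category of partial equivalence relations

module PERCategory (em : ExcludedMiddle 0ℓ) (𝓘 : PureInstance) where
  open Logic em 𝓘
  open Tripos em 𝓘
  open FunctionalRelations em 𝓘
  open IndexedPreorder (effectPreorder 𝓘)
  open TriposToTopos isTripos

  private variable
    A B C     : Set
    X Y       : PER
    Γ         : List Φ
    a b c d e : Λ
    ψ         : Φ

  functional : (F : FunctionalRelation X Y) →
               Γ ⊢[ internalᵉ (isFunctional F) ] Functional X Y (rel F)
  functional F = internalize (isFunctional F)

  -- From G (x , y), totality of F yields y′ with F (x , y′), hence G (x , y′). Single-valuedness of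
  -- G gives y′ ∼ y, and F (x , y) follows by extensionality.
  functional-⊇ : ∀ {F G} → Γ ⊢[ a ] Functional X Y F → Γ ⊢[ b ] Functional X Y G →
                 Γ ⊢[ c ] (F ⊃ G) → Γ ⊢[ _ ] (G ⊃ F)
  functional-⊇ f g F⊆G = ⊃-intro λ (x , y) →
    ⨆-elim (defined (weaken f) (strictˡ (weaken g) h₀)) λ y′ →
      extendʳ (weaken (weaken f)) h₀
        (unique (weaken (weaken g)) (⊃-elim (x , y′) (weaken (weaken F⊆G)) h₀) h₁)

  opaque
    -- Halves the later proofs of equations between morphisms: one inclusion is derived, the other
    -- comes from `functional-⊇`.
    functional-≅ : ∀ {F G} → IsFunctional X Y F → IsFunctional X Y G →
                   (∀ x y → F (x , y) ∷ [] ⊢[ e ] G (x , y)) → F ≅ G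
    functional-≅ {F = F} {G} isF isG F⊆G =
      entails F G (λ (x , y) → F⊆G x y) ,
      entails G F λ (x , y) → ⊃-elim (x , y)
        (functional-⊇ (internalize isF) (internalize isG)
          (⊃-intro λ (x , y) → lemma (F⊆G x y) h₀))
        h₀

  module _ (F : Pr (A × B)) (G : Pr (B × C)) where

    compose-intro : ∀ {x} y {z} → Γ ⊢[ d ] F (x , y) → Γ ⊢[ e ] G (y , z) →
                    Γ ⊢[ _ ] compose G F (x , z)
    compose-intro {x = x} y {z} D E = ⨆-intro ((x , y , z) , refl) (∧-intro D E)

    compose-elim : ∀ {x z} → Γ ⊢[ d ] compose G F (x , z) →
                   (∀ y → F (x , y) ∷ G (y , z) ∷ Γ ⊢[ e ] ψ) → Γ ⊢[ _ ] ψ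
    compose-elim D E = ⨆-elim D λ { ((_ , y , _) , refl) → ∧-elim-head (E y) }

  opaque
    ∼-functional : ∀ X → IsFunctional X X (∼ X)
    ∼-functional X = externalize (functional-intro
      (λ x y → reflexiveˡ X h₀)
      (λ x y → reflexiveʳ X h₀)
      (λ x x′ y y′ → transitive X (symmetric X h₁) (transitive X h₀ h₂))
      (λ x y y′ → transitive X (symmetric X h₀) h₁)
      (λ x → ⨆-intro x h₀))

  opaque
    compose-functional : ∀ {X Y Z}
                         {G : Pr (∣ Y ∣ × ∣ Z ∣)} {F : Pr (∣ X ∣ × ∣ Y ∣)} →
                         IsFunctional Y Z G → IsFunctional X Y F →
                         IsFunctional X Z (compose G F)
    compose-functional {X} {Y} {Z} {G} {F} isG isF = externalize (functional-intro
      (λ x z → compose-elim F G h₀ λ y → strictˡ f h₀)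
      (λ x z → compose-elim F G h₀ λ y → strictʳ g h₁)
      (λ x x′ z z′ → compose-elim F G h₀ λ y →
        compose-intro F G y (extendˡ f h₀ h₃) (extendʳ g h₁ h₄))
      (λ x z z′ → compose-elim F G h₀ λ y → compose-elim F G h₃ λ y′ →
        unique g h₃ (extendˡ g h₁ (unique f h₀ h₂)))
      (λ x → ⨆-elim (defined f h₀) λ y → ⨆-elim (defined g (strictʳ f h₀)) λ z →
        ⨆-intro z (compose-intro F G y h₁ h₀)))
      where
      f : ∀ {Γ} → Γ ⊢[ internalᵉ isF ] Functional X Y F
      f = internalize isF
      g : ∀ {Γ} → Γ ⊢[ internalᵉ isG ] Functional Y Z G
      g = internalize isG

  compose-mono : ∀ {F F′ : Pr (A × B)} {G G′ : Pr (B × C)} →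
                 G ⊑ G′ → F ⊑ F′ → compose G F ⊑ compose G′ F′
  compose-mono {F = F} {F′} {G} {G′} r s =
    entails (compose G F) (compose G′ F′) λ (x , z) →
      compose-elim F G h₀ λ y → compose-intro F′ G′ y
        (apply F F′ s (x , y) h₀) (apply G G′ r (y , z) h₁)

  categorical : IsCategorical
  categorical = record
    { id-functional   = ∼-functional
    ; ∘-functional    = compose-functional
    ; ≈-isEquivalence = λ {X} {Y} → record
      { refl  = λ {F} → ≅-refl (rel F)
      ; sym   = swap
      ; trans = λ {F} {G} {H} (r , r′) (s , s′) →
          ⊑-trans (rel F) (rel G) (rel H) r s , ⊑-trans (rel H) (rel G) (rel F) s′ r′
      }
    ; ∙-resp-≈  = λ F H G K (r , r′) (s , s′) → compose-mono r s , compose-mono r′ s′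
    ; identityˡ = λ {X} {Y} F → functional-≅
        (compose-functional (∼-functional Y) (isFunctional F)) (isFunctional F)
        λ x y → compose-elim (rel F) (∼ Y) h₀ λ y′ → extendʳ (functional F) h₀ h₁
    ; identityʳ = λ {X} {Y} F → functional-≅
        (compose-functional (isFunctional F) (∼-functional X)) (isFunctional F)
        λ x y → compose-elim (∼ X) (rel F) h₀ λ x′ →
          extendˡ (functional F) h₁ (symmetric X h₀)
    ; assoc     = λ F G H → functional-≅
        (compose-functional
          (compose-functional (isFunctional H) (isFunctional G)) (isFunctional F))
        (compose-functional
          (isFunctional H) (compose-functional (isFunctional G) (isFunctional F)))
        λ x w → compose-elim (rel F) (compose (rel H) (rel G)) h₀ λ y →
          compose-elim (rel G) (rel H) h₁ λ z →
            compose-intro (compose (rel G) (rel F)) (rel H) z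
              (compose-intro (rel F) (rel G) y h₂ h₀) h₁
    }

-- Working with morphisms, and graphs of functions

module Topos (em : ExcludedMiddle 0ℓ) (𝓘 : PureInstance) where
  open Logic em 𝓘
  open Tripos em 𝓘
  open FunctionalRelations em 𝓘
  open PERCategory em 𝓘
  open IndexedPreorder (effectPreorder 𝓘) using (Pr)
  open TriposToTopos isTripos
  open IsCategorical categorical
    renaming (_⇒_ to infix 4 _⇒_; _≈_ to infix 4 _≈_; _∙_ to infixr 9 _∙_)

  private variable
    X Y Z     : PER
    Γ         : List Φ
    a b c d e : Λ
    ψ         : Φ

  morphism : ∀ F → IsFunctional X Y F → X ⇒ Y
  morphism F isF = record { isFunctional = isF }

  ≈-intro : (F G : X ⇒ Y) → (∀ x y → rel F (x , y) ∷ [] ⊢[ e ] rel G (x , y)) → F ≈ G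
  ≈-intro F G = functional-≅ (isFunctional F) (isFunctional G)

  ≈-elim : (F G : X ⇒ Y) (F≈G : F ≈ G) → ∀ {x y} →
           Γ ⊢[ e ] rel F (x , y) → Γ ⊢[ _ ] rel G (x , y)
  ≈-elim F G F≈G = apply (rel F) (rel G) (proj₁ F≈G) _

  module _ (F : X ⇒ Y) (G : Y ⇒ Z) where

    ∙-intro : ∀ {x} y {z} → Γ ⊢[ d ] rel F (x , y) → Γ ⊢[ e ] rel G (y , z) →
              Γ ⊢[ _ ] rel (G ∙ F) (x , z)
    ∙-intro = compose-intro (rel F) (rel G)

    ∙-elim : ∀ {x z} → Γ ⊢[ d ] rel (G ∙ F) (x , z) →
             (∀ y → rel F (x , y) ∷ rel G (y , z) ∷ Γ ⊢[ e ] ψ) → Γ ⊢[ _ ] ψ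
    ∙-elim = compose-elim (rel F) (rel G)

  opaque
    -- The conjunct ∼ X (x , x) provides strictness in x, which f x ∼ y alone does not give.
    graph-functional : ∀ X Y (f : ∣ X ∣ → ∣ Y ∣) →
      (∀ x x′ → ∼ X (x , x′) ∷ [] ⊢[ e ] ∼ Y (f x , f x′)) →
      IsFunctional X Y λ (x , y) → ∼ X (x , x) ∧ ∼ Y (f x , y)
    graph-functional X Y f tracked = externalize (functional-intro
      (λ x y → ∧-elimˡ h₀)
      (λ x y → reflexiveʳ Y (∧-elimʳ h₀))
      (λ x x′ y y′ → ∧-intro (reflexiveʳ X h₁)
        (transitive Y (symmetric Y (lemma (tracked x x′) h₁))
          (transitive Y (∧-elimʳ h₀) h₂)))
      (λ x y y′ → transitive Y (symmetric Y (∧-elimʳ h₀)) (∧-elimʳ h₁))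
      (λ x → ⨆-intro (f x) (∧-intro h₀ (lemma (tracked x x) h₀))))

  graph : (f : ∣ X ∣ → ∣ Y ∣) →
          (∀ x x′ → ∼ X (x , x′) ∷ [] ⊢[ e ] ∼ Y (f x , f x′)) → X ⇒ Y
  graph f tracked = morphism _ (graph-functional _ _ f tracked)

  -- Terminal object and binary products

  opaque
    ⊤-isPER : IsPER {Unit} (λ _ → ⊤)
    ⊤-isPER = isPER (λ _ _ → h₀) (λ _ _ _ → h₀)

  𝟙 : PER
  𝟙 = per Unit (λ _ → ⊤) ⊤-isPER

  opaque
    !-functional : IsFunctional X 𝟙 λ (x , _) → ∼ X (x , x)
    !-functional {X} = externalize (functional-intro
      (λ x _ → h₀)
      (λ _ _ → ⊤-intro)
      (λ x x′ _ _ → reflexiveʳ X h₁)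
      (λ _ _ _ → ⊤-intro)
      (λ x → ⨆-intro tt h₀))

  ! : X ⇒ 𝟙
  ! = morphism _ !-functional

  !-unique : (F : X ⇒ 𝟙) → F ≈ !
  !-unique F = ≈-intro F ! λ x y → strictˡ (functional F) h₀

  module _ (X Y : PER) where

    private
      R : Pr ((∣ X ∣ × ∣ Y ∣) × (∣ X ∣ × ∣ Y ∣))
      R ((x , y) , (x′ , y′)) = ∼ X (x , x′) ∧ ∼ Y (y , y′)

    opaque
      ⊗-isPER : IsPER R
      ⊗-isPER = isPER
        (λ _ _ → ∧-intro (symmetric X (∧-elimˡ h₀)) (symmetric Y (∧-elimʳ h₀)))
        (λ _ _ _ → ∧-intro (transitive X (∧-elimˡ h₀) (∧-elimˡ h₁))
                           (transitive Y (∧-elimʳ h₀) (∧-elimʳ h₁)))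

    infixr 7 _⊗_
    _⊗_ : PER
    _⊗_ = per _ R ⊗-isPER

    opaque
      -- The conjunct on the discarded component makes the relation strict on the product.
      fst-functional : IsFunctional _⊗_ X λ ((x , y) , x′) → ∼ X (x , x′) ∧ ∼ Y (y , y)
      fst-functional = externalize (functional-intro
        (λ _ _ → ∧-intro (reflexiveˡ X (∧-elimˡ h₀)) (∧-elimʳ h₀))
        (λ _ _ → reflexiveʳ X (∧-elimˡ h₀))
        (λ _ _ _ _ → ∧-intro
          (transitive X (symmetric X (∧-elimˡ h₁)) (transitive X (∧-elimˡ h₀) h₂))
          (reflexiveʳ Y (∧-elimʳ h₁)))
        (λ _ _ _ → transitive X (symmetric X (∧-elimˡ h₀)) (∧-elimˡ h₁))
        (λ (x , y) → ⨆-intro x h₀))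

      snd-functional : IsFunctional _⊗_ Y λ ((x , y) , y′) → ∼ X (x , x) ∧ ∼ Y (y , y′)
      snd-functional = externalize (functional-intro
        (λ _ _ → ∧-intro (∧-elimˡ h₀) (reflexiveˡ Y (∧-elimʳ h₀)))
        (λ _ _ → reflexiveʳ Y (∧-elimʳ h₀))
        (λ _ _ _ _ → ∧-intro
          (reflexiveʳ X (∧-elimˡ h₁))
          (transitive Y (symmetric Y (∧-elimʳ h₁)) (transitive Y (∧-elimʳ h₀) h₂)))
        (λ _ _ _ → transitive Y (symmetric Y (∧-elimʳ h₀)) (∧-elimʳ h₁))
        (λ (x , y) → ⨆-intro y h₀))

    fst : _⊗_ ⇒ X
    fst = morphism _ fst-functional

    snd : _⊗_ ⇒ Y
    snd = morphism _ snd-functional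

  module _ {Z X Y : PER} (F : Z ⇒ X) (G : Z ⇒ Y) where

    opaque
      ⟨⟩-functional : IsFunctional Z (X ⊗ Y) λ (z , x , y) → rel F (z , x) ∧ rel G (z , y)
      ⟨⟩-functional = externalize (functional-intro
        (λ _ _ → strictˡ (functional F) (∧-elimˡ h₀))
        (λ _ _ → ∧-intro (strictʳ (functional F) (∧-elimˡ h₀))
                         (strictʳ (functional G) (∧-elimʳ h₀)))
        (λ _ _ _ _ → ∧-intro (extend (functional F) (∧-elimˡ h₀) h₁ (∧-elimˡ h₂))
                             (extend (functional G) (∧-elimʳ h₀) h₁ (∧-elimʳ h₂)))
        (λ _ _ _ → ∧-intro (unique (functional F) (∧-elimˡ h₀) (∧-elimˡ h₁))
                           (unique (functional G) (∧-elimʳ h₀) (∧-elimʳ h₁)))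
        (λ z → ⨆-elim (defined (functional F) h₀) λ x →
          ⨆-elim (defined (functional G) h₁) λ y → ⨆-intro (x , y) (∧-intro h₁ h₀)))

    ⟨_,_⟩ : Z ⇒ X ⊗ Y
    ⟨_,_⟩ = morphism _ ⟨⟩-functional

    fst-⟨⟩ : fst X Y ∙ ⟨_,_⟩ ≈ F
    fst-⟨⟩ = ≈-intro (fst X Y ∙ ⟨_,_⟩) F λ z x → ∙-elim ⟨_,_⟩ (fst X Y) h₀ λ _ →
      extendʳ (functional F) (∧-elimˡ h₀) (∧-elimˡ h₁)

    snd-⟨⟩ : snd X Y ∙ ⟨_,_⟩ ≈ G
    snd-⟨⟩ = ≈-intro (snd X Y ∙ ⟨_,_⟩) G λ z x → ∙-elim ⟨_,_⟩ (snd X Y) h₀ λ _ →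
      extendʳ (functional G) (∧-elimʳ h₀) (∧-elimʳ h₁)

    ⟨⟩-unique : (H : Z ⇒ X ⊗ Y) → fst X Y ∙ H ≈ F → snd X Y ∙ H ≈ G → H ≈ ⟨_,_⟩
    ⟨⟩-unique H r s = ≈-intro H ⟨_,_⟩ λ z (x , y) → ∧-intro
      (≈-elim (fst X Y ∙ H) F r
        (∙-intro H (fst X Y) (x , y) h₀ (strictʳ (functional H) h₀)))
      (≈-elim (snd X Y ∙ H) G s
        (∙-intro H (snd X Y) (x , y) h₀ (strictʳ (functional H) h₀)))

  -- Subobjects cut out by predicates, and equalizers

  module Subobject (X : PER) (P : ∣ X ∣ → Φ)
    (P-extensional : ∀ x x′ → ∼ X (x , x′) ∧ P x ∷ [] ⊢[ e ] P x′) where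

    opaque
      Sub-isPER : IsPER λ (x , x′) → ∼ X (x , x′) ∧ P x
      Sub-isPER = isPER
        (λ x x′ → ∧-intro (symmetric X (∧-elimˡ h₀)) (P-extensional x x′))
        (λ _ _ _ → ∧-intro (transitive X (∧-elimˡ h₀) (∧-elimˡ h₁)) (∧-elimʳ h₀))

    Sub : PER
    Sub = per ∣ X ∣ _ Sub-isPER

    opaque
      incl-functional : IsFunctional Sub X λ (x , x′) → ∼ X (x , x′) ∧ P x
      incl-functional = externalize (functional-intro
        (λ _ _ → ∧-intro (reflexiveˡ X (∧-elimˡ h₀)) (∧-elimʳ h₀))
        (λ _ _ → reflexiveʳ X (∧-elimˡ h₀))
        (λ x x′ _ _ → ∧-intro
          (transitive X (symmetric X (∧-elimˡ h₁)) (transitive X (∧-elimˡ h₀) h₂))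
          (lemma (P-extensional x x′) h₁))
        (λ _ _ _ → transitive X (symmetric X (∧-elimˡ h₀)) (∧-elimˡ h₁))
        (λ x → ⨆-intro x h₀))

    incl : Sub ⇒ X
    incl = morphism _ incl-functional

    module _ (F : Z ⇒ X) (F⊆P : ∀ z x → rel F (z , x) ∷ [] ⊢[ d ] P x) where

      opaque
        -- The relation of F is kept. Over `Sub`, strictness and single-valuedness additionally ask
        -- for P, which F⊆P supplies.
        factor-functional : IsFunctional Z Sub (rel F)
        factor-functional = externalize (functional-intro
          (λ _ _ → strictˡ (functional F) h₀)
          (λ _ _ → ∧-intro (strictʳ (functional F) h₀) (lemma (F⊆P _ _) h₀))
          (λ _ _ _ _ → extend (functional F) h₀ h₁ (∧-elimˡ h₂))
          (λ _ _ _ → ∧-intro (unique (functional F) h₀ h₁) (lemma (F⊆P _ _) h₀))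
          (λ _ → defined (functional F) h₀))

      factor : Z ⇒ Sub
      factor = morphism _ factor-functional

      incl-∙-factor : incl ∙ factor ≈ F
      incl-∙-factor = ≈-intro (incl ∙ factor) F λ _ _ →
        ∙-elim factor incl h₀ λ _ → extendʳ (functional F) h₀ (∧-elimˡ h₁)

      factor-unique : (K : Z ⇒ Sub) → incl ∙ K ≈ F → K ≈ factor
      factor-unique K r = ≈-intro K factor λ _ x →
        ≈-elim (incl ∙ K) F r (∙-intro K incl x h₀ (strictʳ (functional K) h₀))

  module Equalizer (F G : X ⇒ Y) where

    agree : ∣ X ∣ → Φ
    agree x = ⨆ λ y → rel F (x , y) ∧ rel G (x , y)

    agree-extensional : ∀ x x′ → ∼ X (x , x′) ∧ agree x ∷ [] ⊢[ _ ] agree x′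
    agree-extensional x x′ = ⨆-elim (∧-elimʳ h₀) λ y → ⨆-intro y (∧-intro
      (extendˡ (functional F) (∧-elimˡ h₀) (∧-elimˡ h₁))
      (extendˡ (functional G) (∧-elimʳ h₀) (∧-elimˡ h₁)))

    open Subobject X agree agree-extensional public

    commute : F ∙ incl ≈ G ∙ incl
    commute = ≈-intro (F ∙ incl) (G ∙ incl) λ x y → ∙-elim incl F h₀ λ x′ →
      ⨆-elim (∧-elimʳ h₀) λ y′ → ∙-intro incl G x
        (∧-intro (reflexiveˡ X (∧-elimˡ h₁)) (∧-elimʳ h₁))
        (extendʳ (functional G) (∧-elimʳ h₀) (unique (functional F) (∧-elimˡ h₀)
          (extendˡ (functional F) h₂ (symmetric X (∧-elimˡ h₁)))))

    -- The value y of F at x is also a value of G ∙ H at z, through some x′; single-valuedness of H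
    -- gives x′ ∼ x, so G takes the value y at x.
    equalized : (H : Z ⇒ X) (r : F ∙ H ≈ G ∙ H) → ∀ z x →
                rel H (z , x) ∷ [] ⊢[ _ ] agree x
    equalized H r z x = ⨆-elim (defined (functional F) (strictʳ (functional H) h₀)) λ y →
      ∙-elim H G (≈-elim (F ∙ H) (G ∙ H) r (∙-intro H F x h₁ h₀)) λ x′ →
        ⨆-intro y (∧-intro h₂
          (extendˡ (functional G) h₁ (unique (functional H) h₀ h₃)))

  -- Exponentials

  opaque
    -- The carrier holds all relations between X and Y; those related to themselves are the
    -- internally functional ones, identified when they imply each other.
    ⇑-isPER : ∀ X Y → IsPER λ (F , G) →
              Functional X Y F ∧ Functional X Y G ∧ (F ⊃ G) ∧ (G ⊃ F)
    ⇑-isPER X Y = isPER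
      (λ F G → ∧-intro (∧-elimˡ (∧-elimʳ h₀)) (∧-intro (∧-elimˡ h₀) (∧-intro
        (∧-elimʳ (∧-elimʳ (∧-elimʳ h₀))) (∧-elimˡ (∧-elimʳ (∧-elimʳ h₀))))))
      (λ F G H → ∧-intro (∧-elimˡ h₀) (∧-intro (∧-elimˡ (∧-elimʳ h₁)) (∧-intro
        (⊃-intro λ p → ⊃-elim p (∧-elimˡ (∧-elimʳ (∧-elimʳ h₂)))
          (⊃-elim p (∧-elimˡ (∧-elimʳ (∧-elimʳ h₁))) h₀))
        (⊃-intro λ p → ⊃-elim p (∧-elimʳ (∧-elimʳ (∧-elimʳ h₁)))
          (⊃-elim p (∧-elimʳ (∧-elimʳ (∧-elimʳ h₂))) h₀)))))

  _⇑_ : PER → PER → PER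
  Y ⇑ X = per (∣ X ∣ × ∣ Y ∣ → Φ) _ (⇑-isPER X Y)

  ⇑-intro : ∀ {X Y F G} → Γ ⊢[ a ] Functional X Y F → Γ ⊢[ b ] Functional X Y G →
            Γ ⊢[ c ] (F ⊃ G) → Γ ⊢[ _ ] ∼ (Y ⇑ X) (F , G)
  ⇑-intro f g F⊆G =
    ∧-intro f (∧-intro g (∧-intro F⊆G (functional-⊇ f g F⊆G)))

  module _ (X Y : PER) where

    opaque
      eval-functional : IsFunctional ((Y ⇑ X) ⊗ X) Y
                        λ ((F , x) , y) → ∼ (Y ⇑ X) (F , F) ∧ F (x , y)
      eval-functional = externalize (functional-intro
        (λ _ _ → ∧-intro (∧-elimˡ h₀) (strictˡ (∧-elimˡ (∧-elimˡ h₀)) (∧-elimʳ h₀)))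
        (λ _ _ → strictʳ (∧-elimˡ (∧-elimˡ h₀)) (∧-elimʳ h₀))
        (λ (F , x) (G , x′) y y′ → ∧-intro (reflexiveʳ (Y ⇑ X) (∧-elimˡ h₁))
          (extend (∧-elimˡ (∧-elimʳ (∧-elimˡ h₁)))
            (⊃-elim (x , y) (∧-elimˡ (∧-elimʳ (∧-elimʳ (∧-elimˡ h₁)))) (∧-elimʳ h₀))
            (∧-elimʳ h₁) h₂))
        (λ _ _ _ → unique (∧-elimˡ (∧-elimˡ h₀)) (∧-elimʳ h₀) (∧-elimʳ h₁))
        (λ _ → ⨆-elim (defined (∧-elimˡ (∧-elimˡ h₀)) (∧-elimʳ h₀)) λ y →
          ⨆-intro y (∧-intro (∧-elimˡ h₁) h₀)))

    eval : (Y ⇑ X) ⊗ X ⇒ Y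
    eval = morphism _ eval-functional

  module _ {Z X Y} (F : Z ⊗ X ⇒ Y) where

    section : ∣ Z ∣ → ∣ X ∣ × ∣ Y ∣ → Φ
    section z (x , y) = rel F ((z , x) , y)

    section-functional : ∀ {z} → Γ ⊢[ e ] ∼ Z (z , z) →
                         Γ ⊢[ _ ] Functional X Y (section z)
    section-functional z∼z = functional-intro
      (λ _ _ → ∧-elimʳ (strictˡ (functional F) h₀))
      (λ _ _ → strictʳ (functional F) h₀)
      (λ _ _ _ _ → extend (functional F) h₀
        (∧-intro (weaken (weaken (weaken z∼z))) h₁) h₂)
      (λ _ _ _ → unique (functional F) h₀ h₁)
      (λ _ → defined (functional F) (∧-intro (weaken z∼z) h₀))

    section-tracked : ∀ z z′ → ∼ Z (z , z′) ∷ [] ⊢[ _ ]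
                      ∼ (Y ⇑ X) (section z , section z′)
    section-tracked z z′ = ⇑-intro
      (section-functional (reflexiveˡ Z h₀)) (section-functional (reflexiveʳ Z h₀))
      (⊃-intro λ (x , y) → extendˡ (functional F) h₀
        (∧-intro h₁ (∧-elimʳ (strictˡ (functional F) h₀))))

    curry : Z ⇒ Y ⇑ X
    curry = graph section section-tracked

    eval-curry : eval X Y ∙ ⟨ curry ∙ fst Z X , snd Z X ⟩ ≈ F
    eval-curry = ≈-intro (eval X Y ∙ ⟨ curry ∙ fst Z X , snd Z X ⟩) F λ (z , x) y →
      ∙-elim ⟨ curry ∙ fst Z X , snd Z X ⟩ (eval X Y) h₀ λ (G , x′) →
      ∙-elim (fst Z X) curry (∧-elimˡ h₀) λ z′ → extendˡ (functional F)
        -- `curry` relates z′ to any G equivalent to the section at z′; the implication from G to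
        -- that section turns G (x′ , y) into F at (z′ , x′).
        (⊃-elim (x′ , y) (∧-elimʳ (∧-elimʳ (∧-elimʳ (∧-elimʳ h₁)))) (∧-elimʳ h₃))
        (∧-intro (symmetric Z (∧-elimˡ h₀)) (symmetric X (∧-elimʳ (∧-elimʳ h₂))))

    curry-unique : (G : Z ⇒ Y ⇑ X) → eval X Y ∙ ⟨ G ∙ fst Z X , snd Z X ⟩ ≈ F → G ≈ curry
    curry-unique G r = ≈-intro G curry λ z H → ∧-intro (strictˡ (functional G) h₀)
      (symmetric (Y ⇑ X) (⇑-intro
        (∧-elimˡ (strictʳ (functional G) h₀))
        (section-functional (strictˡ (functional G) h₀))
        -- H (x , y) makes the composite with `eval` relate (z , x) to y through (H , x), so F does
        -- too. The cut makes z ∼ z and x ∼ x available as one hypothesis.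
        (⊃-intro λ (x , y) → cut (paired z H x y)
          (≈-elim (eval X Y ∙ ⟨ G ∙ fst Z X , snd Z X ⟩) F r
          (∙-intro ⟨ G ∙ fst Z X , snd Z X ⟩ (eval X Y) (H , x)
            (∧-intro (∙-intro (fst Z X) G z h₀ h₂) (∧-intro (∧-elimˡ h₀) (∧-elimʳ h₀)))
            (∧-intro (strictʳ (functional G) h₂) h₁))))))
      where
      paired : ∀ z H x y → H (x , y) ∷ rel G (z , H) ∷ Γ ⊢[ _ ]
               ∼ (Z ⊗ X) ((z , x) , (z , x))
      paired z H x y = ∧-intro (strictˡ (functional G) h₁)
        (strictˡ (∧-elimˡ (strictʳ (functional G) h₁)) h₀)

  -- The subobject classifier

  opaque
    ⟺-isPER : IsPER λ (φ , ψ) → (φ ⟹ ψ) ∧ (ψ ⟹ φ)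
    ⟺-isPER = isPER
      (λ φ ψ → ∧-intro (∧-elimʳ h₀) (∧-elimˡ h₀))
      (λ φ ψ χ → ∧-intro
        (⟹-intro (⟹-elim (∧-elimˡ h₂) (⟹-elim (∧-elimˡ h₁) h₀)))
        (⟹-intro (⟹-elim (∧-elimʳ h₁) (⟹-elim (∧-elimʳ h₂) h₀))))

  Ω : PER
  Ω = per Φ _ ⟺-isPER

  true : 𝟙 ⇒ Ω
  true = graph (λ _ → ⊤) λ _ _ → ∧-intro (⟹-intro h₀) (⟹-intro h₀)

  module _ {U A : PER} (m : U ⇒ A) where

    -- A categorical mono is injective in the internal logic because its
    -- composites with the two projections of the kernel pair agree.
    module KernelPair where

      open Subobject (U ⊗ U) (λ (u , u′) → ⨆ λ a → rel m (u , a) ∧ rel m (u′ , a))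
        (λ _ _ → ⨆-elim (∧-elimʳ h₀) λ a → ⨆-intro a (∧-intro
          (extendˡ (functional m) (∧-elimˡ h₀) (∧-elimˡ (∧-elimˡ h₁)))
          (extendˡ (functional m) (∧-elimʳ h₀) (∧-elimʳ (∧-elimˡ h₁)))))

      left right : Sub ⇒ U
      left  = graph proj₁ λ _ _ → ∧-elimˡ (∧-elimˡ h₀)
      right = graph proj₂ λ _ _ → ∧-elimʳ (∧-elimˡ h₀)

      m∙left≈m∙right : m ∙ left ≈ m ∙ right
      m∙left≈m∙right = ≈-intro (m ∙ left) (m ∙ right) λ (u , u′) a →
        ∙-elim left m h₀ λ w → ⨆-elim (∧-elimʳ (∧-elimˡ h₀)) λ a₀ →
          ∙-intro right m u′
            (∧-intro (∧-elimˡ h₁) (∧-elimʳ (∧-elimˡ (∧-elimˡ h₁))))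
            (extendʳ (functional m) (∧-elimʳ h₀) (unique (functional m) (∧-elimˡ h₀)
              (extendˡ (functional m) h₂ (symmetric U (∧-elimʳ h₁)))))

    opaque
      monic-injective : Mono category m → ∃[ e ] ∀ u u′ a →
                        rel m (u , a) ∷ rel m (u′ , a) ∷ [] ⊢[ e ] ∼ U (u , u′)
      monic-injective mono = _ , λ u u′ a → symmetric U (∧-elimʳ
        -- At the point (u , u′) of the kernel pair, `left` takes the value u; hence so does
        -- `right`, which means u′ ∼ u.
        (≈-elim left right (mono left right m∙left≈m∙right)
          (∧-intro (∧-intro
            (∧-intro (strictˡ (functional m) h₀) (strictˡ (functional m) h₁))
            (⨆-intro a (∧-intro h₀ h₁))) (strictˡ (functional m) h₀))))
        where open KernelPair

    image : ∣ A ∣ → Φ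
    image a = ⨆ λ u → rel m (u , a)

    χ : A ⇒ Ω
    χ = graph image λ a a′ → ∧-intro
      (⟹-intro (⨆-elim h₀ λ u → ⨆-intro u (extendʳ (functional m) h₀ h₂)))
      (⟹-intro (⨆-elim h₀ λ u →
        ⨆-intro u (extendʳ (functional m) h₀ (symmetric A h₂))))

    χ-commute : χ ∙ m ≈ true ∙ !
    χ-commute = ≈-intro (χ ∙ m) (true ∙ !) λ u φ → ∙-elim m χ h₀ λ a →
      ∙-intro (! {U}) true tt (strictˡ (functional m) h₀)
        (∧-intro ⊤-intro (∧-intro
          (⟹-intro (⟹-elim (∧-elimˡ (∧-elimʳ h₂)) (⨆-intro u h₁)))
          (⟹-intro ⊤-intro)))

  -- `true` relates its point only to propositions equivalent to ⊤, and the commuting square makes φ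
  -- one of them.
  classified : (c : X ⇒ Ω) (F : Z ⇒ X) (k : Z ⇒ 𝟙) → (r : c ∙ F ≈ true ∙ k) →
               ∀ z x φ → rel F (z , x) ∷ rel c (x , φ) ∷ [] ⊢[ _ ] φ
  classified c F k r z x φ =
    ∙-elim k true (≈-elim (c ∙ F) (true ∙ k) r (∙-intro F c x h₀ h₁)) λ _ →
      ⟹-elim (∧-elimˡ (∧-elimʳ h₁)) ⊤-intro

  module _ {U A : PER} (m : U ⇒ A) (mono : Mono category m) where

    module _ (F : Z ⇒ A) (k : Z ⇒ 𝟙) (r : χ m ∙ F ≈ true ∙ k) where

      covered : ∀ z a → rel F (z , a) ∷ [] ⊢[ _ ] image m a
      -- Among the propositions that `χ m` relates to a, `image m a` itself is chosen.
      covered z a = lemma₂ (classified (χ m) F k r z a (image m a)) h₀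
        (∧-intro (strictʳ (functional F) h₀) (∧-intro (⟹-intro h₀) (⟹-intro h₀)))

      opaque
        -- F followed by the converse of m: single-valued because m is injective in the logic, total
        -- by `covered`.
        lift-functional : IsFunctional Z U
                          λ (z , u) → ⨆ λ a → rel F (z , a) ∧ rel m (u , a)
        lift-functional = externalize (functional-intro
          (λ _ _ → ⨆-elim h₀ λ a → strictˡ (functional F) (∧-elimˡ h₀))
          (λ _ _ → ⨆-elim h₀ λ a → strictˡ (functional m) (∧-elimʳ h₀))
          (λ _ _ _ _ → ⨆-elim h₀ λ a → ⨆-intro a (∧-intro
            (extendˡ (functional F) (∧-elimˡ h₀) h₂)
            (extendˡ (functional m) (∧-elimʳ h₀) h₃)))
          (λ z u u′ → ⨆-elim h₀ λ a → ⨆-elim h₂ λ a′ →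
            lemma₂ (proj₂ (monic-injective m mono) u u′ a) (∧-elimʳ h₁)
              (extendʳ (functional m) (∧-elimʳ h₀)
                (unique (functional F) (∧-elimˡ h₀) (∧-elimˡ h₁))))
          (λ z → ⨆-elim (defined (functional F) h₀) λ a →
            ⨆-elim (lemma (covered z a) h₀) λ u →
              ⨆-intro u (⨆-intro a (∧-intro h₁ h₀))))

      lift-along : Z ⇒ U
      lift-along = morphism _ lift-functional

      m∙lift-along : m ∙ lift-along ≈ F
      m∙lift-along = ≈-intro (m ∙ lift-along) F λ z a → ∙-elim lift-along m h₀ λ u →
        ⨆-elim h₀ λ a′ → extendʳ (functional F) (∧-elimˡ h₀)
          (unique (functional m) (∧-elimʳ h₀) h₂)

      !∙lift-along : ! ∙ lift-along ≈ k
      !∙lift-along = ≈-intro (! ∙ lift-along) k λ z _ → ∙-elim lift-along ! h₀ λ u →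
        ⨆-elim (defined (functional k) (strictˡ (functional lift-along) h₀)) λ _ → h₀

      lift-along-unique : (G : Z ⇒ U) → m ∙ G ≈ F → G ≈ lift-along
      lift-along-unique G s = ≈-intro G lift-along λ z u →
        ⨆-elim (defined (functional m) (strictʳ (functional G) h₀)) λ a →
          ⨆-intro a (∧-intro (≈-elim (m ∙ G) F s (∙-intro G m u h₁ h₀)) h₀)

    χ-pullback : IsPullback category m ! (χ m) true
    χ-pullback = record
      { commute     = χ-commute m
      ; universal   = lift-along
      ; p∙universal = λ {_} {F} {k} r → m∙lift-along F k r
      ; q∙universal = λ {_} {F} {k} r → !∙lift-along F k r
      ; unique      = λ {_} {F} {k} r G s _ → lift-along-unique F k r G s
      }

  χ-unique : ∀ {U A} (m : U ⇒ A) (c : A ⇒ Ω) → IsPullback category m ! c true → c ≈ χ m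
  χ-unique {U} {A} m c pullback = ≈-intro c (χ m) λ a φ →
    ∧-intro (strictˡ (functional c) h₀) (∧-intro
      (⟹-intro (⨆-elim h₀ λ u → lemma₂ (classified c m ! commute u a φ) h₀ h₂))
      -- Assuming φ makes φ and ⊤ equal in Ω, so c (a , φ) becomes c (a , ⊤).
      (⟹-intro (lemma (holds⇒image a) (extendʳ (functional c) h₁
        (∧-intro (⟹-intro ⊤-intro) (⟹-intro h₁))))))
    where
    -- The pullback property is applied to the subobject of A on which c holds.
    open IsPullback pullback using (commute; universal; p∙universal)
    open Subobject A (λ a → rel c (a , ⊤))
      (λ _ _ → extendˡ (functional c) (∧-elimʳ h₀) (∧-elimˡ h₀))

    c∙incl≈true : c ∙ incl ≈ true ∙ !
    c∙incl≈true = ≈-intro (c ∙ incl) (true ∙ !) λ a φ → ∙-elim incl c h₀ λ a′ →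
      ∙-intro (! {Sub}) true tt (∧-intro (reflexiveˡ A (∧-elimˡ h₀)) (∧-elimʳ h₀))
        (∧-intro ⊤-intro (unique (functional c) (∧-elimʳ h₀)
          (extendˡ (functional c) h₁ (symmetric A (∧-elimˡ h₀)))))

    k : Sub ⇒ U
    k = universal incl ! c∙incl≈true

    -- Here a is a point of `Sub`, so k gives it a value u, and m ∙ k ≈ incl forces the value of m
    -- at u to be a up to ∼.
    holds⇒image : ∀ a → rel c (a , ⊤) ∷ [] ⊢[ _ ] image m a
    holds⇒image a =
      ⨆-elim (defined (functional k) (∧-intro (strictˡ (functional c) h₀) h₀)) λ u →
      ⨆-elim (defined (functional m) (strictʳ (functional k) h₀)) λ a′ →
        ⨆-intro u (extendʳ (functional m) h₀ (symmetric A (∧-elimˡ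
          (≈-elim (m ∙ k) incl (p∙universal c∙incl≈true) (∙-intro k m u h₁ h₀)))))

  isTopos : IsTopos category
  isTopos = record
    { 𝟙 = 𝟙
    ; ! = !
    ; !-unique = !-unique
    ; _⊗_ = _⊗_
    ; fst = λ {X} {Y} → fst X Y
    ; snd = λ {X} {Y} → snd X Y
    ; ⟨_,_⟩ = ⟨_,_⟩
    ; fst-⟨⟩ = fst-⟨⟩
    ; snd-⟨⟩ = snd-⟨⟩
    ; ⟨⟩-unique = ⟨⟩-unique
    ; Eq = Equalizer.Sub
    ; eq = Equalizer.incl
    ; eq-commute = Equalizer.commute
    ; eq-factor = λ F G H r → Equalizer.factor F G H (Equalizer.equalized F G H r)
    ; eq-∙-factor = λ F G H r →
        Equalizer.incl-∙-factor F G H (Equalizer.equalized F G H r)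
    ; eq-unique = λ F G H r → Equalizer.factor-unique F G H (Equalizer.equalized F G H r)
    ; _⇑_ = _⇑_
    ; eval = λ {X} {Y} → eval X Y
    ; curry = curry
    ; eval-curry = eval-curry
    ; curry-unique = curry-unique
    ; Ω = Ω
    ; true = true
    ; χ = λ m _ → χ m
    ; χ-pullback = χ-pullback
    ; χ-unique = λ m _ → χ-unique m
    }

corollary9 : ExcludedMiddle 0ℓ → (𝓘 : PureInstance) →
    Σ[ t ∈ IsTripos (effectPreorder 𝓘) ] YieldsTopos t
corollary9 em 𝓘 = Tripos.isTripos em 𝓘 , PERCategory.categorical em 𝓘 , Topos.isTopos em 𝓘
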